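{- Let $d\geq 14$ be an integer with $d\neq 15$ and $d\neq 17$. Then every $d$-regular graph $G$ can be decomposed into two graphs each of which fulfills the 1--2--3 Conjecture.
   Context: All graphs are finite and simple. A decomposition of a graph $G=(V,E)$ into $k$ graphs is a partition $E=E_1\cup\dots\cup E_k$ (parts may be empty), the graphs being $G_i=(V,E_i)$. For an edge-weighting $\omega:E\to\{1,2,3\}$ of a graph $G=(V,E)$, the sum at a vertex $v$ is $s_\omega(v)=\sum_{e\ni v}\omega(e)$. A graph $G$ fulfills the 1--2--3 Conjecture if there exists $\omega:E\to\{1,2,3\}$ with $s_\omega(u)\neq s_\omega(v)$ for every edge $uv\in E$ (an edgeless graph fulfills it trivially). -}

module Defs where

open import Data.Nat using (ℕ; _≤_)
open import Data.Fin using (Fin)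
open import Data.List using (map; allFin)
open import Data.Nat.ListAction using (sum)
open import Data.Bool using (Bool; true; false; if_then_else_; _∧_; _∨_)
open import Data.Product using (Σ; _×_)
open import Relation.Binary.PropositionalEquality using (_≡_; _≢_)

record Graph (n : ℕ) : Set where
  field
    adj   : Fin n → Fin n → Bool
    sym   : ∀ u v → adj u v ≡ adj v u
    irrefl : ∀ v → adj v v ≡ false
open Graph public

degree : ∀ {n} → Graph n → Fin n → ℕ
degree {n} G v = sum (map (λ u → if adj G v u then 1 else 0) (allFin n))

Regular : ∀ {n} → ℕ → Graph n → Set
Regular d G = ∀ v → degree G v ≡ d

-- An edge weighting: a symmetric function on pairs (only its values on
-- edges matter), taking values in {1,2,3} on every edge.
record Weighting {n : ℕ} (G : Graph n) : Set where
  field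
    ω      : Fin n → Fin n → ℕ
    ω-sym  : ∀ u v → ω u v ≡ ω v u
    ω-range : ∀ u v → adj G u v ≡ true → (1 ≤ ω u v) × (ω u v ≤ 3)
open Weighting public

vsum : ∀ {n} {G : Graph n} → Weighting G → Fin n → ℕ
vsum {n} {G} w v = sum (map (λ u → if adj G v u then ω w v u else 0) (allFin n))

Fulfills123 : ∀ {n} → Graph n → Set
Fulfills123 G = Σ (Weighting G) λ w → ∀ u v → adj G u v ≡ true → vsum w u ≢ vsum w v

DecomposedInto : ∀ {n} → Graph n → Graph n → Graph n → Set
DecomposedInto G G₁ G₂ =
  (∀ u v → adj G u v ≡ (adj G₁ u v ∨ adj G₂ u v)) ×
  (∀ u v → (adj G₁ u v ∧ adj G₂ u v) ≡ false)

{-# OPTIONS --safe #-}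
module Submission where

-- Choose a maximal family of pairwise non-adjacent triples of vertices, each
-- inducing a path or a triangle, and let I be its union.  Put the edges inside
-- I into G₂, give the edges between I and its complement R weight 1 in G₁, and
-- weight the edges inside R with 1, 2, 3 in G₁ by Kalkowski's algorithm.  The
-- bit that the algorithm needs at a vertex v of R with a neighbour in I is
-- realised by moving one edge from v to I from G₁ to G₂.  Since G is d-regular,
-- G₁ has sums at least d on R, and less than d on I because every vertex of I
-- has a neighbour in I.  In G₂ the components are triples with pendant edges.
-- By maximality the vertices of R without a neighbour in I induce a graph of
-- maximum degree at most 1.  They are treated last, adjacent ones in pairs.

open import Defs renaming (sym to adj-sym; irrefl to adj-irrefl)
open import Algebra.Properties.CommutativeMonoid.Sum using ()
open import Data.Bool as Bool using (Bool; true; false; if_then_else_; _∧_; _∨_; not; T?)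
open import Data.Bool.Properties
  using (T-≡; ∧-comm; ∨-comm; if-eta; ∧-zeroʳ; ∨-zeroʳ; ∧-identityʳ; ∨-identityʳ)
open import Data.Fin using (Fin; zero; suc; toℕ; _≟_)
open import Data.Fin.Properties using (injective⇒≤; ¬∀⟶∃¬; any?; toℕ<n; toℕ-injective)
open import Data.List
  using (List; []; _∷_; map; allFin; length; lookup; filterᵇ; tabulate; cartesianProduct)
import Data.List.Membership.DecPropositional as DecMembership
open import Data.List.Membership.Propositional using (_∈_; _∉_)
open import Data.List.Membership.Propositional.Properties
  using (∈-allFin; ∈-map⁺; ∈-filter⁺; ∈-cartesianProduct⁺)
open import Data.List.Properties using (map-tabulate; length-map)
open import Data.List.Relation.Unary.Any using (here; there; index)
open import Data.List.Relation.Unary.Any.Properties using (lookup-index)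
open import Data.Nat as Nat using (ℕ; zero; suc; _+_; _≤_; _<_; z≤n; s≤s)
open import Data.Nat.ListAction using (sum)
open import Data.Nat.Properties hiding (_≟_)
open import Data.Nat.Solver using (module +-*-Solver)
open import Data.Product using (Σ; ∃; _×_; _,_; proj₁; proj₂)
open import Data.Sum as Sum using (_⊎_; inj₁; inj₂)
open import Function using (_∘_; Equivalence)
open import Relation.Binary.PropositionalEquality
  using (_≡_; _≢_; refl; sym; trans; cong; cong₂; subst; subst₂; module ≡-Reasoning)
open import Relation.Nullary using (¬_; Dec; yes; no; does; contradiction; _×-dec_; _⊎-dec_; ¬?)
open import Relation.Nullary.Decidable using (dec-true; dec-false)
open +-*-Solver using (solve; _:+_; _:=_; con)
open Algebra.Properties.CommutativeMonoid.Sum +-0-commutativeMonoid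
  using (sum-cong-≗; ∑-distrib-+) renaming (sum to ∑)

-- Kalkowski's argument weights vertices as well as edges; the second graph is there to absorb the
-- vertex weights. Why triples: a vertex of I without a neighbour in I could keep all its edges in
-- G₁ and reach the sum d, and a component of G₂ that is a single edge cannot be weighted at all,
-- since both ends get the same sum. With three vertices, labels from 1, 2, 3 separate the sums for
-- any numbers of pendant edges. These numbers are known only once the algorithm has fixed the bits,
-- so the weights inside I are provided for every `p`. The price is that R may contain adjacent
-- vertices without a neighbour in I. Such a vertex has no bit to spend: as a treated neighbour it
-- forbids a value without offering a change in return. Treated last, a lone one sees only
-- neighbours with a usable bit. In an adjacent pair the second vertex is one option short; the edge
-- between the two makes up for it, because the first vertex can reach its total with two different
-- weights of that edge.

private
  variable
    n : ℕ

-- Indicators and finite sums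

⟦_⟧ : Bool → ℕ
⟦ b ⟧ = if b then 1 else 0

sum-allFin : (f : Fin n → ℕ) → sum (map f (allFin n)) ≡ ∑ f
sum-allFin {n} f = trans (cong sum (map-tabulate {n = n} (λ i → i) f)) (go f)
  where
  go : ∀ {m} (g : Fin m → ℕ) → sum (tabulate g) ≡ ∑ g
  go {zero}  g = refl
  go {suc m} g = cong (g zero +_) (go (g ∘ suc))

∑-mono : {f g : Fin n → ℕ} → (∀ i → f i ≤ g i) → ∑ f ≤ ∑ g
∑-mono {zero}  f≤g = z≤n
∑-mono {suc n} f≤g = +-mono-≤ (f≤g zero) (∑-mono (f≤g ∘ suc))

∑-mono-< : {f g : Fin n → ℕ} → (∀ i → f i ≤ g i) → ∀ k → f k < g k → ∑ f < ∑ g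
∑-mono-< f≤g zero    fk<gk = +-mono-<-≤ fk<gk (∑-mono (f≤g ∘ suc))
∑-mono-< f≤g (suc k) fk<gk = +-mono-≤-< (f≤g zero) (∑-mono-< (f≤g ∘ suc) k fk<gk)

∑-zero : {f : Fin n → ℕ} → (∀ i → f i ≡ 0) → ∑ f ≡ 0
∑-zero {zero}  f≡0 = refl
∑-zero {suc n} f≡0 = cong₂ _+_ (f≡0 zero) (∑-zero (f≡0 ∘ suc))

-- The sums differ exactly as the terms at `k` do; the crosswise form avoids subtraction in ℕ.
∑-change : {f g : Fin n → ℕ} (k : Fin n) → (∀ i → i ≢ k → f i ≡ g i) →
           f k + ∑ g ≡ g k + ∑ f
∑-change {f = f} {g} zero f≡g
  rewrite sum-cong-≗ {_} {f ∘ suc} {g ∘ suc} (λ i → f≡g (suc i) λ ()) =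
  solve 3 (λ x y s → x :+ (y :+ s) := y :+ (x :+ s)) refl (f zero) (g zero) (∑ (g ∘ suc))
∑-change {f = f} {g} (suc k) f≡g
  with f zero | f≡g zero (λ ()) | ∑-change {f = f ∘ suc} {g ∘ suc} k (λ i i≢k → f≡g (suc i) λ { refl → i≢k refl })
... | .(g zero) | refl | ih = begin
  f (suc k) + (g zero + ∑ (g ∘ suc))  ≡⟨ swap (f (suc k)) (g zero) _ ⟩
  g zero + (f (suc k) + ∑ (g ∘ suc))  ≡⟨ cong (g zero +_) ih ⟩
  g zero + (g (suc k) + ∑ (f ∘ suc))  ≡⟨ swap (g zero) (g (suc k)) _ ⟩
  g (suc k) + (g zero + ∑ (f ∘ suc))  ∎
  where
  open ≡-Reasoning
  swap : ∀ x y s → x + (y + s) ≡ y + (x + s)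
  swap = solve 3 (λ x y s → x :+ (y :+ s) := y :+ (x :+ s)) refl

∑-single : {f : Fin n → ℕ} (k : Fin n) → (∀ i → i ≢ k → f i ≡ 0) → ∑ f ≡ f k
∑-single {n} {f} k f≡0 = begin
  ∑ f                     ≡⟨ ∑-change {f = f} {λ _ → 0} k f≡0 ⟨
  f k + ∑ {n} (λ _ → 0)   ≡⟨ cong (f k +_) (∑-zero {n} (λ _ → refl)) ⟩
  f k + 0                 ≡⟨ +-identityʳ (f k) ⟩
  f k                     ∎
  where open ≡-Reasoning

term≤∑ : (f : Fin n → ℕ) (k : Fin n) → f k ≤ ∑ f
term≤∑ f zero    = m≤m+n (f zero) _
term≤∑ f (suc k) = ≤-trans (term≤∑ (f ∘ suc) k) (m≤n+m _ (f zero))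

-- Pigeonhole: values outside a forbidden list

escape : ∀ {m} (g : Fin m → ℕ) → (∀ {i j} → g i ≡ g j → i ≡ j) →
         (xs : List ℕ) → length xs < m → ∃ λ i → g i ∉ xs
escape {m} g g-inj xs xs<m = ¬∀⟶∃¬ m (λ i → g i ∈ xs) (λ i → g i ∈? xs) λ all →
  -- If every value lay in `xs`, its position there would inject `Fin m` into the smaller index set
  -- of `xs`.
  <⇒≱ xs<m (injective⇒≤ {f = λ i → index (all i)} λ {i} {j} eq →
    g-inj (trans (lookup-index (all i)) (trans (cong (lookup xs) eq) (sym (lookup-index (all j))))))
  where open DecMembership Nat._≟_ using (_∈?_)

values : (Fin n → Bool) → (Fin n → ℕ) → List ℕ
values {n} F val = map val (filterᵇ F (allFin n))

length-values : (F : Fin n → Bool) (val : Fin n → ℕ) → length (values F val) ≡ ∑ (λ u → ⟦ F u ⟧)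
length-values {n} F val = trans (length-map val (filterᵇ F (allFin n)))
  (trans (go (allFin n)) (sum-allFin (λ u → ⟦ F u ⟧)))
  where
  go : ∀ us → length (filterᵇ F us) ≡ sum (map (λ u → ⟦ F u ⟧) us)
  go []       = refl
  go (u ∷ us) with F u
  ... | true  = cong suc (go us)
  ... | false = go us

∈-values : (F : Fin n → Bool) (val : Fin n → ℕ) (u : Fin n) → F u ≡ true → val u ∈ values F val
∈-values F val u Fu = ∈-map⁺ val (∈-filter⁺ (T? ∘ F) (∈-allFin u) (Equivalence.from T-≡ Fu))

-- This is the count behind a single treatment: k neighbours forbid at most k of k + 1 consecutive
-- totals.
escape-interval : (lo : ℕ) (xs : List ℕ) → ∃ λ j → j ≤ length xs × lo + j ∉ xs
escape-interval lo xs with escape {suc (length xs)} (λ i → lo + toℕ i)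
    (λ eq → toℕ-injective (+-cancelˡ-≡ lo _ _ eq)) xs ≤-refl
... | i , ∉xs = toℕ i , ≤-pred (toℕ<n i) , ∉xs

-- The intervals have k + 1 elements each, so their union has at least k + 2.
escape-two-intervals : ∀ lo lo′ → lo < lo′ → (xs : List ℕ) → ∀ k → length xs ≤ suc k →
  (∃ λ j → j ≤ k × lo + j ∉ xs) ⊎ (∃ λ j → j ≤ k × lo′ + j ∉ xs)
escape-two-intervals lo lo′ lo<lo′ xs k len = split (escape g (λ eq → g-inj _ _ eq) xs (s≤s len))
  where
  g : Fin (suc (suc k)) → ℕ
  g zero    = lo′ + k
  g (suc i) = lo + toℕ i
  lt : ∀ (i : Fin (suc k)) → lo + toℕ i < lo′ + k
  lt i = +-mono-<-≤ lo<lo′ (≤-pred (toℕ<n i))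
  g-inj : ∀ i j → g i ≡ g j → i ≡ j
  g-inj zero    zero    eq = refl
  g-inj zero    (suc j) eq = contradiction (sym eq) (<⇒≢ (lt j))
  g-inj (suc i) zero    eq = contradiction eq (<⇒≢ (lt i))
  g-inj (suc i) (suc j) eq = cong suc (toℕ-injective (+-cancelˡ-≡ lo _ _ eq))
  split : (∃ λ i → g i ∉ xs) → _
  split (zero  , ∉xs) = inj₂ (k , ≤-refl , ∉xs)
  split (suc i , ∉xs) = inj₁ (toℕ i , ≤-pred (toℕ<n i) , ∉xs)

-- Selections of prescribed size

selected : (F r : Fin n → Bool) → ℕ
selected F r = ∑ (λ u → if F u then ⟦ r u ⟧ else 0)

unselected : (F r : Fin n → Bool) → selected F r < ∑ (λ u → ⟦ F u ⟧) →
             ∃ λ u → F u ≡ true × r u ≡ false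
unselected {n} F r lt with any? (λ u → F u Bool.≟ true ×-dec r u Bool.≟ false)
... | yes found = found
... | no none = contradiction (∑-mono le) (<⇒≱ lt)
  where
  le : ∀ u → ⟦ F u ⟧ ≤ (if F u then ⟦ r u ⟧ else 0)
  le u with F u in Fu | r u in ru
  ... | false | _     = z≤n
  ... | true  | true  = ≤-refl
  ... | true  | false = contradiction (u , Fu , ru) none

-- Besides the count, the inclusion of `r` in `r⁺` matters: raising more edges at one vertex of a
-- pair can only lower the bits that the other one finds at their common neighbours.
enlarge : (F r : Fin n → Bool) → selected F r < ∑ (λ u → ⟦ F u ⟧) →
          ∃ λ r⁺ → selected F r⁺ ≡ suc (selected F r) × (∀ u → ⟦ r u ⟧ ≤ ⟦ r⁺ u ⟧)
enlarge {n} F r lt with unselected F r lt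
... | k , Fk , rk = r⁺ , count , mono
  where
  r⁺ : Fin n → Bool
  r⁺ u = does (u ≟ k) ∨ r u
  mono : ∀ u → ⟦ r u ⟧ ≤ ⟦ r⁺ u ⟧
  mono u with u ≟ k | r u
  ... | yes _ | false = z≤n
  ... | yes _ | true  = ≤-refl
  ... | no  _ | _     = ≤-refl
  at-k : (if F k then ⟦ r k ⟧ else 0) ≡ 0
  at-k rewrite Fk | rk = refl
  at-k⁺ : (if F k then ⟦ r⁺ k ⟧ else 0) ≡ 1
  at-k⁺ rewrite Fk | dec-true (k ≟ k) refl = refl
  off : ∀ u → u ≢ k → (if F u then ⟦ r⁺ u ⟧ else 0) ≡ (if F u then ⟦ r u ⟧ else 0)
  off u u≢k rewrite dec-false (u ≟ k) u≢k = refl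
  count : selected F r⁺ ≡ suc (selected F r)
  count with ∑-change k off
  ... | eq rewrite at-k | at-k⁺ = sym eq

select : (F : Fin n → Bool) → ∀ j → j ≤ ∑ (λ u → ⟦ F u ⟧) → ∃ λ r → selected F r ≡ j
select {n} F zero    j≤ = (λ _ → false) , ∑-zero {n} λ u → if-eta (F u)
select F (suc j) j< with select F j (<⇒≤ j<)
... | r , refl with enlarge F r j<
... | r⁺ , eq , _ = r⁺ , eq

-- Vertex sets as Boolean functions

≟-refl : (v : Fin n) → does (v ≟ v) ≡ true
≟-refl v = dec-true (v ≟ v) refl

≟-≢ : {u v : Fin n} → u ≢ v → does (u ≟ v) ≡ false
≟-≢ {u = u} {v} = dec-false (u ≟ v)

insert : Fin n → (Fin n → Bool) → Fin n → Bool
insert v L u = does (u ≟ v) ∨ L u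

insert-new : (v : Fin n) (L : Fin n → Bool) → insert v L v ≡ true
insert-new v L rewrite ≟-refl v = refl

insert-old : (v : Fin n) {L : Fin n → Bool} {u : Fin n} → L u ≡ true → insert v L u ≡ true
insert-old v {u = u} Lu rewrite Lu = ∨-zeroʳ (does (u ≟ v))

insert⁻ : (v : Fin n) (L : Fin n → Bool) {u : Fin n} → insert v L u ≡ true → u ≡ v ⊎ L u ≡ true
insert⁻ v L {u = u} eq with u ≟ v
... | yes u≡v = inj₁ u≡v
... | no  _   = inj₂ eq

∉-insert⁻ : (v : Fin n) (L : Fin n → Bool) {u : Fin n} → insert v L u ≡ false → u ≢ v × L u ≡ false
∉-insert⁻ v L {u = u} eq with u ≟ v
... | no u≢v = u≢v , eq

true≢false : {b : Bool} → b ≡ true → b ≢ false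
true≢false refl ()

∧-split : ∀ {a b} → a ∧ b ≡ true → a ≡ true × b ≡ true
∧-split {true} eq = refl , eq

-- The edge to the treated vertex goes from 2 to 1 + `b` + `ρ` and the bit from `b` to 1 - `ρ`; edge
-- and bit together make 2 + `b` before and after.
bit-compensates : ∀ ρ b γ {s s′} → 2 + s′ ≡ suc (⟦ b ⟧ + ⟦ ρ ⟧) + s →
                  ⟦ not ρ ⟧ + (γ + s′) ≡ ⟦ b ⟧ + (γ + s)
-- Adding 1 + `ρ` turns the new bit into the constant 2, to which the hypothesis applies.
bit-compensates ρ b γ {s} {s′} eq = +-cancelˡ-≡ (suc ⟦ ρ ⟧) _ _ (begin
  suc ⟦ ρ ⟧ + (⟦ not ρ ⟧ + (γ + s′))  ≡⟨ complement ρ ⟩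
  γ + (2 + s′)                        ≡⟨ cong (γ +_) eq ⟩
  γ + (suc (⟦ b ⟧ + ⟦ ρ ⟧) + s)
    ≡⟨ solve 4 (λ γ x y s → γ :+ (con 1 :+ (x :+ y) :+ s) := con 1 :+ y :+ (x :+ (γ :+ s))) refl γ ⟦ b ⟧ ⟦ ρ ⟧ s ⟩
  suc ⟦ ρ ⟧ + (⟦ b ⟧ + (γ + s))       ∎)
  where
  open ≡-Reasoning
  complement : ∀ ρ → suc ⟦ ρ ⟧ + (⟦ not ρ ⟧ + (γ + s′)) ≡ γ + (2 + s′)
  complement true  = solve 2 (λ γ s → con 2 :+ (γ :+ s) := γ :+ (con 2 :+ s)) refl γ s′
  complement false = solve 2 (λ γ s → con 1 :+ (con 1 :+ (γ :+ s)) := γ :+ (con 2 :+ s)) refl γ s′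

-- Kalkowski's algorithm.  A mobile vertex carries a bit; raising (lowering)
-- an edge between a mobile vertex and the vertex being treated is compensated
-- by the bit of the mobile vertex, whose total therefore never changes.
module Kalkowski {n : ℕ} (A : Fin n → Fin n → Bool)
  (A-sym : ∀ u v → A u v ≡ A v u) (A-irrefl : ∀ v → A v v ≡ false)
  (M : Fin n → Bool) (c : Fin n → ℕ) where

  -- States of the algorithm and their invariant

  record State : Set where
    constructor state
    field
      W : Fin n → Fin n → ℕ
      β : Fin n → Bool
  open State

  deg : Fin n → ℕ
  deg v = ∑ λ u → ⟦ A v u ⟧

  -- The bit acts as a vertex weight, and `c` stands for edges outside `A` whose contribution stays
  -- constant.
  total : State → Fin n → ℕ
  total σ v = ⟦ β σ v ⟧ + (c v + ∑ λ u → if A v u then W σ v u else 0)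

  -- Here `L` is the set of treated vertices. `fresh` keeps an edge at the middle weight 2 until its
  -- untreated end comes up, but only towards mobile vertices, so that an edge between two immobile
  -- ones may still be reweighted. By `bit`, only a treated mobile vertex can have bit 0.
  record Good (L : Fin n → Bool) (σ : State) : Set where
    field
      W-sym     : ∀ u v → W σ u v ≡ W σ v u
      W-range   : ∀ u v → 1 ≤ W σ u v × W σ u v ≤ 3
      fresh     : ∀ u v → L u ≡ false → M v ≡ true → W σ u v ≡ 2
      bit       : ∀ u → L u ≡ false ⊎ M u ≡ false → β σ u ≡ true
      distinct  : ∀ u v → L u ≡ true → L v ≡ true → A u v ≡ true → total σ u ≢ total σ v
      large     : ∀ u → L u ≡ true → suc (c u + deg u) ≤ total σ u
  open Good

  -- These are the edges at `v` whose other end can absorb a change: it must be mobile to have a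
  -- usable bit, and treated because an untreated vertex has to keep bit 1.
  flip : (Fin n → Bool) → Fin n → Fin n → Bool
  flip L v u = A v u ∧ (L u ∧ M u)

  flip⁻ : ∀ L v u → flip L v u ≡ true → A v u ≡ true × L u ≡ true × M u ≡ true
  flip⁻ L v u eq with ∧-split {A v u} eq
  ... | Avu , eq′ = Avu , ∧-split eq′

  flip⁺ : ∀ L v u → A v u ≡ true → L u ≡ true → M u ≡ true → flip L v u ≡ true
  flip⁺ L v u p q r rewrite p | q | r = refl

  flips : (Fin n → Bool) → Fin n → ℕ
  flips L v = ∑ λ u → ⟦ flip L v u ⟧

  -- A neighbour with bit 1 lets its edge be 2 or 3, one with bit 0 lets it be 1 or 2; the smaller
  -- option is taken.
  floor : (Fin n → Bool) → State → Fin n → Fin n → ℕ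
  floor L σ v u = if flip L v u then suc ⟦ β σ u ⟧ else W σ v u

  low : (Fin n → Bool) → State → Fin n → ℕ
  low L σ v = ⟦ β σ v ⟧ + (c v + ∑ λ u → if A v u then floor L σ v u else 0)

  -- One move of the algorithm

  module _ (L : Fin n → Bool) (v : Fin n) (r : Fin n → Bool) (σ : State) where

    raised : Fin n → ℕ
    raised u = if flip L v u then suc (⟦ β σ u ⟧ + ⟦ r u ⟧) else W σ v u

    move : State
    W move u t = if does (u ≟ v) then raised t else (if does (t ≟ v) then raised u else W σ u t)
    β move u   = if flip L v u then not (r u) else β σ u

    W-from : ∀ t → W move v t ≡ raised t
    W-from t rewrite ≟-refl v = refl

    W-to : ∀ u → u ≢ v → W move u v ≡ raised u
    W-to u u≢v rewrite ≟-≢ u≢v | ≟-refl v = refl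

    W-off : ∀ u t → u ≢ v → t ≢ v → W move u t ≡ W σ u t
    W-off u t u≢v t≢v rewrite ≟-≢ u≢v | ≟-≢ t≢v = refl

    total-moved : L v ≡ false → total move v ≡ low L σ v + selected (flip L v) r
    total-moved v∉L = begin
      ⟦ β move v ⟧ + (c v + ∑ (λ u → if A v u then W move v u else 0))
        ≡⟨ cong₂ (λ b s → ⟦ b ⟧ + (c v + s)) same-bit (trans (sum-cong-≗ split)
             (∑-distrib-+ (λ u → if A v u then floor L σ v u else 0) _)) ⟩
      ⟦ β σ v ⟧ + (c v + (∑ (λ u → if A v u then floor L σ v u else 0) + selected (flip L v) r))
        ≡⟨ solve 4 (λ a b s t → a :+ (b :+ (s :+ t)) := a :+ (b :+ s) :+ t) refl ⟦ β σ v ⟧ (c v) _ _ ⟩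
      low L σ v + selected (flip L v) r ∎
      where
      open ≡-Reasoning
      same-bit : β move v ≡ β σ v
      same-bit rewrite A-irrefl v = refl
      split : ∀ u → (if A v u then W move v u else 0) ≡
        (if A v u then floor L σ v u else 0) + (if flip L v u then ⟦ r u ⟧ else 0)
      split u rewrite W-from u with A v u | L u ∧ M u
      ... | false | _     = refl
      ... | true  | true  = refl
      ... | true  | false = sym (+-identityʳ _)

    -- At an unflipped `u` neither the edge nor the bit changes. A flipped `u` is mobile while `v`
    -- is untreated, so by `fresh` their edge had weight 2 and the new bit of `u` makes up for the
    -- new weight.
    total-kept : Good L σ → L v ≡ false → ∀ u → u ≢ v → total move u ≡ total σ u
    total-kept g v∉L u u≢v = by-cases (flip L v u) refl
      where
      unflipped : flip L v u ≡ false → ∀ t → Dec (t ≡ v) → W move u t ≡ W σ u t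
      unflipped Fu t (yes refl) rewrite W-to u u≢v | Fu = W-sym g v u
      unflipped Fu t (no  t≢v)  = W-off u t u≢v t≢v
      f f′ : Fin n → ℕ
      f  t = if A u t then W σ u t else 0
      f′ t = if A u t then W move u t else 0
      f-v : A v u ≡ true → M u ≡ true → f v ≡ 2
      f-v Avu Mu rewrite A-sym u v | Avu | W-sym g u v = fresh g v u v∉L Mu
      f′-v : A v u ≡ true → flip L v u ≡ true → f′ v ≡ suc (⟦ β σ u ⟧ + ⟦ r u ⟧)
      f′-v Avu Fu rewrite W-to u u≢v | Fu | A-sym u v | Avu = refl
      changed : A v u ≡ true → M u ≡ true → flip L v u ≡ true →
        2 + ∑ f′ ≡ suc (⟦ β σ u ⟧ + ⟦ r u ⟧) + ∑ f
      changed Avu Mu Fu = subst₂ (λ x y → x + ∑ f′ ≡ y + ∑ f) (f-v Avu Mu) (f′-v Avu Fu)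
        (∑-change {f = f} {f′} v λ t t≢v → cong (λ x → if A u t then x else 0) (sym (W-off u t u≢v t≢v)))
      by-cases : ∀ b → flip L v u ≡ b → total move u ≡ total σ u
      by-cases false Fu = cong₂ (λ b s → ⟦ b ⟧ + (c u + s))
        (cong (λ b → if b then not (r u) else β σ u) Fu)
        (sum-cong-≗ λ t → cong (λ x → if A u t then x else 0) (unflipped Fu t (t ≟ v)))
      by-cases true Fu with flip⁻ L v u Fu
      ... | Avu , _ , Mu = trans
        (cong (λ b → ⟦ if b then not (r u) else β σ u ⟧ + (c u + ∑ f′)) Fu)
        (bit-compensates (r u) (β σ u) (c u) (changed Avu Mu Fu))

    raised-range : Good L σ → ∀ u → 1 ≤ raised u × raised u ≤ 3
    raised-range g u with flip L v u
    ... | false = W-range g v u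
    ... | true  = s≤s z≤n , s≤s (+-mono-≤ (⟦⟧≤1 (β σ u)) (⟦⟧≤1 (r u)))
      where
      ⟦⟧≤1 : ∀ b → ⟦ b ⟧ ≤ 1
      ⟦⟧≤1 true  = ≤-refl
      ⟦⟧≤1 false = z≤n

    move-good : Good L σ → L v ≡ false →
      (∀ u → L u ≡ true → A v u ≡ true → total σ u ≢ low L σ v + selected (flip L v) r) →
      Good (insert v L) move
    move-good g v∉L avoid = record
      { W-sym = W-sym′ ; W-range = range ; fresh = fresh′ ; bit = bit′
      ; distinct = distinct′ ; large = large′ }
      where
      W-sym′ : ∀ u t → W move u t ≡ W move t u
      W-sym′ u t with u ≟ v | t ≟ v
      ... | yes refl | yes refl = refl
      ... | yes _    | no _     = refl
      ... | no _     | yes _    = refl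
      ... | no _     | no _     = W-sym g u t
      range : ∀ u t → 1 ≤ W move u t × W move u t ≤ 3
      range u t with u ≟ v | t ≟ v
      ... | yes _ | _     = raised-range g t
      ... | no _  | yes _ = raised-range g u
      ... | no _  | no _  = W-range g u t
      fresh′ : ∀ u t → insert v L u ≡ false → M t ≡ true → W move u t ≡ 2
      fresh′ u t u∉ Mt = go (∉-insert⁻ v L u∉) (t ≟ v)
        where
        go : u ≢ v × L u ≡ false → Dec (t ≡ v) → W move u t ≡ 2
        go (u≢v , u∉L) (no t≢v) = trans (W-off u t u≢v t≢v) (fresh g u t u∉L Mt)
        go (u≢v , u∉L) (yes refl) rewrite W-to u u≢v | u∉L | ∧-zeroʳ (A v u) =
          trans (W-sym g v u) (fresh g u v u∉L Mt)
      bit′ : ∀ u → insert v L u ≡ false ⊎ M u ≡ false → β move u ≡ true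
      bit′ u h with flip L v u in Fu
      bit′ u (inj₁ u∉) | false = bit g u (inj₁ (proj₂ (∉-insert⁻ v L u∉)))
      bit′ u (inj₂ u∉) | false = bit g u (inj₂ u∉)
      bit′ u (inj₁ u∉) | true  = contradiction (proj₂ (∉-insert⁻ v L u∉)) (true≢false (proj₁ (proj₂ (flip⁻ L v u Fu))))
      bit′ u (inj₂ u∉) | true  = contradiction u∉ (true≢false (proj₂ (proj₂ (flip⁻ L v u Fu))))
      ne : ∀ u → L u ≡ true → A v u ≡ true → total move u ≢ total move v
      ne u Lu Avu eq = avoid u Lu Avu (begin
        total σ u     ≡⟨ total-kept g v∉L u (λ { refl → true≢false Lu v∉L }) ⟨
        total move u  ≡⟨ eq ⟩
        total move v  ≡⟨ total-moved v∉L ⟩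
        _             ∎)
        where open ≡-Reasoning
      distinct′ : ∀ u t → insert v L u ≡ true → insert v L t ≡ true → A u t ≡ true → total move u ≢ total move t
      distinct′ u t u∈ t∈ Aut with insert⁻ v L {u} u∈ | insert⁻ v L t∈
      ... | inj₁ refl | inj₁ refl = contradiction (A-irrefl v) (true≢false Aut)
      ... | inj₁ refl | inj₂ Lt   = ne t Lt Aut ∘ sym
      ... | inj₂ Lu   | inj₁ refl = ne u Lu (trans (A-sym v u) Aut)
      ... | inj₂ Lu   | inj₂ Lt   = subst₂ _≢_ (kept u Lu) (kept t Lt) (distinct g u t Lu Lt Aut)
        where
        kept : ∀ u → L u ≡ true → total σ u ≡ total move u
        kept u Lu = sym (total-kept g v∉L u λ { refl → true≢false Lu v∉L })
      -- When `v` is treated its bit is still 1 and every edge weighs at least 1; afterwards its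
      -- total is frozen.
      large′ : ∀ u → insert v L u ≡ true → suc (c u + deg u) ≤ total move u
      large′ u u∈ = go (insert⁻ v L {u} u∈)
        where
        at-least-one : ∀ t → ⟦ A v t ⟧ ≤ (if A v t then W move v t else 0)
        bit-v : β move v ≡ true
        bit-v rewrite A-irrefl v = bit g v (inj₁ v∉L)
        go : u ≡ v ⊎ L u ≡ true → suc (c u + deg u) ≤ total move u
        go (inj₂ Lu)   = subst (suc (c u + deg u) ≤_)
          (sym (total-kept g v∉L u λ { refl → true≢false Lu v∉L })) (large g u Lu)
        go (inj₁ refl) = subst (λ b → suc (c v + deg v) ≤ ⟦ b ⟧ + (c v + ∑ (λ t → if A v t then W move v t else 0))) (sym bit-v)
          (s≤s (+-monoʳ-≤ (c v) (∑-mono at-least-one)))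
        at-least-one t with A v t | range v t
        ... | false | _       = z≤n
        ... | true  | W≥1 , _ = W≥1

  -- Every treated neighbour forbids one total of `v`, but being mobile it also lengthens the
  -- interval of attainable totals by one, so one attainable total stays free.
  treat-by-flips : ∀ L σ v → Good L σ → L v ≡ false →
    (∀ u → L u ≡ true → A v u ≡ true → M u ≡ true) → ∃ λ σ′ → Good (insert v L) σ′
  treat-by-flips L σ v g v∉L mobile
    with escape-interval (low L σ v) (values (flip L v) (total σ))
  ... | j , j≤ , ∉forbidden
    with select (flip L v) j (subst (j ≤_) (length-values (flip L v) (total σ)) j≤)
  ... | r , refl = move L v r σ , move-good L v r σ g v∉L λ u Lu Avu eq →
    ∉forbidden (subst (_∈ values (flip L v) (total σ)) eq
      (∈-values (flip L v) (total σ) u (flip⁺ L v u Avu Lu (mobile u Lu Avu))))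

  -- Adjacent pairs of immobile vertices

  module Pair (L : Fin n → Bool) (σ : State) (g : Good L σ) (v v′ : Fin n)
    (v∉L : L v ≡ false) (v′∉L : L v′ ≡ false) (Avv′ : A v v′ ≡ true)
    (v∉M : M v ≡ false) (v′∉M : M v′ ≡ false)
    (nbr  : ∀ u → A v u ≡ true → u ≢ v′ → L u ≡ true × M u ≡ true)
    (nbr′ : ∀ u → A v′ u ≡ true → u ≢ v → L u ≡ true × M u ≡ true) where

    v≢v′ : v ≢ v′
    v≢v′ refl = true≢false Avv′ (A-irrefl v)

    joins : Fin n → Fin n → Bool
    joins u t = (does (u ≟ v) ∧ does (t ≟ v′)) ∨ (does (u ≟ v′) ∧ does (t ≟ v))

    joins-sym : ∀ u t → joins u t ≡ joins t u
    joins-sym u t = trans (∨-comm (does (u ≟ v) ∧ does (t ≟ v′)) _)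
      (cong₂ _∨_ (∧-comm (does (u ≟ v′)) _) (∧-comm (does (u ≟ v)) _))

    weigh : ℕ → State
    W (weigh x) u t = if joins u t then x else W σ u t
    β (weigh x) = β σ

    joins-pair : joins v v′ ≡ true
    joins-pair rewrite ≟-refl v | ≟-refl v′ = refl

    joins-≢ʳ : ∀ u t → t ≢ v → t ≢ v′ → joins u t ≡ false
    joins-≢ʳ u t t≢v t≢v′ rewrite ≟-≢ t≢v | ≟-≢ t≢v′
      | ∧-zeroʳ (does (u ≟ v)) | ∧-zeroʳ (does (u ≟ v′)) = refl

    joins-≢ˡ : ∀ u t → u ≢ v → u ≢ v′ → joins u t ≡ false
    joins-≢ˡ u t u≢v u≢v′ = trans (joins-sym u t) (joins-≢ʳ t u u≢v u≢v′)

    L⇒≢ : ∀ {u} → L u ≡ true → u ≢ v × u ≢ v′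
    L⇒≢ Lu = (λ { refl → true≢false Lu v∉L }) , (λ { refl → true≢false Lu v′∉L })

    M⇒≢ : ∀ {u} → M u ≡ true → u ≢ v × u ≢ v′
    M⇒≢ Mu = (λ { refl → true≢false Mu v∉M }) , (λ { refl → true≢false Mu v′∉M })

    total-weigh : ∀ x u → L u ≡ true → total (weigh x) u ≡ total σ u
    total-weigh x u Lu = cong (λ s → ⟦ β σ u ⟧ + (c u + s)) (sum-cong-≗ λ t →
      cong (λ b → if A u t then (if b then x else W σ u t) else 0)
        (joins-≢ˡ u t (proj₁ (L⇒≢ Lu)) (proj₂ (L⇒≢ Lu))))

    -- Both mates are untreated and immobile: `distinct` and `large` speak of treated vertices, and
    -- `fresh` of pairs with a mobile second vertex.
    weigh-good : ∀ x → 1 ≤ x → x ≤ 3 → Good L (weigh x)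
    weigh-good x 1≤x x≤3 = record
      { W-sym = λ u t → cong₂ (λ b w → if b then x else w) (joins-sym u t) (W-sym g u t)
      ; W-range = range
      ; fresh = λ u t u∉L Mt → trans
          (cong (λ b → if b then x else W σ u t) (joins-≢ʳ u t (proj₁ (M⇒≢ Mt)) (proj₂ (M⇒≢ Mt))))
          (fresh g u t u∉L Mt)
      ; bit = bit g
      ; distinct = λ u t Lu Lt Aut → subst₂ _≢_ (sym (total-weigh x u Lu)) (sym (total-weigh x t Lt))
          (distinct g u t Lu Lt Aut)
      ; large = λ u Lu → subst (suc (c u + deg u) ≤_) (sym (total-weigh x u Lu)) (large g u Lu)
      }
      where
      range : ∀ u t → 1 ≤ W (weigh x) u t × W (weigh x) u t ≤ 3
      range u t with joins u t
      ... | true  = 1≤x , x≤3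
      ... | false = W-range g u t

    flip-pair : flip L v v′ ≡ false
    flip-pair rewrite v′∉L = ∧-zeroʳ (A v v′)

    low-weigh : ∀ x → low L (weigh (suc x)) v ≡ suc (low L (weigh x) v)
    low-weigh x = begin
      ⟦ β σ v ⟧ + (c v + ∑ (f (suc x)))  ≡⟨ cong (λ s → ⟦ β σ v ⟧ + (c v + s)) step ⟩
      ⟦ β σ v ⟧ + (c v + suc (∑ (f x)))  ≡⟨ solve 3 (λ a b s → a :+ (b :+ (con 1 :+ s)) := con 1 :+ (a :+ (b :+ s))) refl ⟦ β σ v ⟧ (c v) (∑ (f x)) ⟩
      suc (low L (weigh x) v)            ∎
      where
      open ≡-Reasoning
      f : ℕ → Fin n → ℕ
      f y t = if A v t then floor L (weigh y) v t else 0
      f-v′ : ∀ y → f y v′ ≡ y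
      f-v′ y rewrite Avv′ | v′∉L | joins-pair = refl
      off : ∀ t → t ≢ v′ → f (suc x) t ≡ f x t
      off t t≢v′ rewrite ≟-≢ t≢v′ | ≟-≢ v≢v′ | ∧-zeroʳ (does (v ≟ v)) = refl
      step : ∑ (f (suc x)) ≡ suc (∑ (f x))
      step = +-cancelˡ-≡ x _ _ (begin
        x + ∑ (f (suc x))       ≡⟨ cong (_+ ∑ (f (suc x))) (f-v′ x) ⟨
        f x v′ + ∑ (f (suc x))  ≡⟨ ∑-change v′ off ⟨
        f (suc x) v′ + ∑ (f x)  ≡⟨ cong (_+ ∑ (f x)) (f-v′ (suc x)) ⟩
        suc x + ∑ (f x)         ≡⟨ +-suc x _ ⟨
        x + suc (∑ (f x))       ∎)

    L₁ : Fin n → Bool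
    L₁ = insert v L

    v′∉L₁ : L₁ v′ ≡ false
    v′∉L₁ rewrite ≟-≢ (v≢v′ ∘ sym) = v′∉L

    -- Trading one unit on the edge v v′ for one raised edge at v leaves the
    -- total of v unchanged but moves the interval of totals available to v′.
    low-trade : ∀ x r r⁺ → (∀ u → ⟦ r u ⟧ ≤ ⟦ r⁺ u ⟧) →
      low L₁ (move L v r⁺ (weigh x)) v′ < low L₁ (move L v r (weigh (suc x))) v′
    low-trade x r r⁺ r≤r⁺ = +-mono-≤-< (≤-reflexive (cong ⟦_⟧ (trans (same-bit r⁺) (sym (same-bit r)))))
      (+-monoʳ-< (c v′) (∑-mono-< (λ u → pointwise u (u ≟ v)) v at-v))
      where
      τ = move L v r⁺ (weigh x)
      τ⁺ = move L v r (weigh (suc x))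
      same-bit : ∀ ρ → (if flip L v v′ then not (ρ v′) else β σ v′) ≡ β σ v′
      same-bit ρ = cong (λ b → if b then not (ρ v′) else β σ v′) flip-pair
      f f⁺ : Fin n → ℕ
      f  u = if A v′ u then floor L₁ τ v′ u else 0
      f⁺ u = if A v′ u then floor L₁ τ⁺ v′ u else 0
      floor-v : ∀ y ρ → (if A v′ v then floor L₁ (move L v ρ (weigh y)) v′ v else 0) ≡ y
      floor-v y ρ = trans
        (cong₂ (λ a b → if a then (if b then suc ⟦ β (move L v ρ (weigh y)) v ⟧ else W (move L v ρ (weigh y)) v′ v) else 0)
          (trans (A-sym v′ v) Avv′) flip-v)
        (trans (W-to L v ρ (weigh y) v′ (v≢v′ ∘ sym))
        (trans (cong (λ b → if b then suc (⟦ β σ v′ ⟧ + ⟦ ρ v′ ⟧) else W (weigh y) v v′) flip-pair)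
          (cong (λ b → if b then y else W σ v v′) joins-pair)))
        where
        flip-v : flip L₁ v′ v ≡ false
        flip-v rewrite v∉M | ∧-zeroʳ (L₁ v) = ∧-zeroʳ (A v′ v)
      at-v : f v < f⁺ v
      at-v = subst₂ _<_ (sym (floor-v x r⁺)) (sym (floor-v (suc x) r)) ≤-refl
      antitone : ∀ a b → ⟦ a ⟧ ≤ ⟦ b ⟧ → ⟦ not b ⟧ ≤ ⟦ not a ⟧
      antitone true  true  _ = z≤n
      antitone false true  _ = z≤n
      antitone false false _ = ≤-refl
      bits : ∀ u → ⟦ β τ u ⟧ ≤ ⟦ β τ⁺ u ⟧
      bits u with flip L v u
      ... | true  = antitone (r u) (r⁺ u) (r≤r⁺ u)
      ... | false = ≤-refl
      mobile : ∀ u → u ≢ v → A v′ u ≡ true → f u ≤ f⁺ u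
      mobile u u≢v Av′u with nbr′ u Av′u u≢v
      ... | Lu , Mu = subst₂ _≤_ (sym (flipped τ)) (sym (flipped τ⁺)) (s≤s (bits u))
        where
        flipped : ∀ ρ → (if A v′ u then floor L₁ ρ v′ u else 0) ≡ suc ⟦ β ρ u ⟧
        flipped ρ = cong₂ (λ a b → if a then (if b then suc ⟦ β ρ u ⟧ else W ρ v′ u) else 0)
          Av′u (flip⁺ L₁ v′ u Av′u (insert-old v {L} Lu) Mu)
      pointwise : ∀ u → Dec (u ≡ v) → f u ≤ f⁺ u
      pointwise u (yes refl) = <⇒≤ at-v
      pointwise u (no u≢v) = by-cases (A v′ u) refl
        where
        by-cases : ∀ b → A v′ u ≡ b → f u ≤ f⁺ u
        by-cases true  eq = mobile u u≢v eq
        by-cases false eq rewrite eq = z≤n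

    -- Totals in `L` agree in `τ` and `σ`, so forbidden values are listed by `σ` and one list serves
    -- both candidates for `τ`. The extra entry `s` comes from `v`, the one treated neighbour of
    -- `v′` that cannot be flipped.
    finish : ∀ (s : ℕ) τ → Good L₁ τ → total τ v ≡ s → (∀ u → L u ≡ true → total τ u ≡ total σ u) →
      (∃ λ j → j ≤ flips L₁ v′ × low L₁ τ v′ + j ∉ s ∷ values (flip L₁ v′) (total σ)) →
      ∃ λ σ′ → Good (insert v′ L₁) σ′
    finish s τ gτ τv kept (j , j≤ , ∉forbidden) with select (flip L₁ v′) j j≤
    ... | r , refl = move L₁ v′ r τ , move-good L₁ v′ r τ gτ v′∉L₁ avoid
      where
      avoid : ∀ u → L₁ u ≡ true → A v′ u ≡ true → total τ u ≢ low L₁ τ v′ + selected (flip L₁ v′) r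
      avoid u L₁u Av′u eq with insert⁻ v L L₁u
      ... | inj₁ refl = ∉forbidden (here (trans (sym eq) τv))
      ... | inj₂ Lu   = ∉forbidden (there (subst (_∈ values (flip L₁ v′) (total σ))
        (trans (sym (kept u Lu)) eq)
        (∈-values (flip L₁ v′) (total σ) u
          (flip⁺ L₁ v′ u Av′u L₁u (proj₂ (nbr′ u Av′u (proj₁ (L⇒≢ Lu))))))))

    -- The total `s` of `v` arises in two ways: weight `x` on the edge to `v′` with `j` + 1 raised
    -- edges, or weight `x` + 1 with `j` raised edges. If `v′` has k flippable neighbours, k + 1
    -- values are forbidden to it; they may fill one interval of k + 1 totals, but not both of the
    -- shifted ones.
    treat-trading : ∀ x → 1 ≤ x → suc x ≤ 3 → ∀ j → suc j ≤ flips L v →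
      low L (weigh x) v + suc j ∉ values (flip L v) (total σ) →
      ∃ λ σ′ → Good (insert v′ L₁) σ′
    treat-trading x 1≤x x<3 j j< ∉forbidden with select (flip L v) j (<⇒≤ j<)
    ... | r , refl with enlarge (flip L v) r j<
    ... | r⁺ , count , r≤r⁺ =
      conclude (escape-two-intervals (low L₁ τ v′) (low L₁ τ⁺ v′) (low-trade x r r⁺ r≤r⁺)
        (s ∷ values (flip L₁ v′) (total σ)) (flips L₁ v′)
        (s≤s (≤-reflexive (length-values (flip L₁ v′) (total σ)))))
      where
      s = low L (weigh x) v + suc (selected (flip L v) r)
      τ = move L v r⁺ (weigh x)
      τ⁺ = move L v r (weigh (suc x))
      avoid : ∀ u → L u ≡ true → A v u ≡ true → total σ u ≢ s
      avoid u Lu Avu eq = ∉forbidden (subst (_∈ values (flip L v) (total σ)) eq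
        (∈-values (flip L v) (total σ) u (flip⁺ L v u Avu Lu (proj₂ (nbr u Avu (proj₂ (L⇒≢ Lu)))))))
      value : low L (weigh x) v + selected (flip L v) r⁺ ≡ s
      value = cong (low L (weigh x) v +_) count
      value⁺ : low L (weigh (suc x)) v + selected (flip L v) r ≡ s
      value⁺ rewrite low-weigh x = sym (+-suc _ _)
      treated : ∀ y ρ → 1 ≤ y → y ≤ 3 → low L (weigh y) v + selected (flip L v) ρ ≡ s →
        Good L₁ (move L v ρ (weigh y))
      treated y ρ 1≤y y≤3 eq = move-good L v ρ (weigh y) (weigh-good y 1≤y y≤3) v∉L
        λ u Lu Avu eq′ → avoid u Lu Avu (trans (sym (total-weigh y u Lu)) (trans eq′ eq))
      kept : ∀ y ρ → 1 ≤ y → y ≤ 3 → ∀ u → L u ≡ true → total (move L v ρ (weigh y)) u ≡ total σ u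
      kept y ρ 1≤y y≤3 u Lu = trans
        (total-kept L v ρ (weigh y) (weigh-good y 1≤y y≤3) v∉L u (proj₁ (L⇒≢ Lu))) (total-weigh y u Lu)
      conclude : _ → ∃ λ σ′ → Good (insert v′ L₁) σ′
      conclude (inj₁ found) = finish s τ (treated x r⁺ 1≤x (<⇒≤ x<3) value)
        (trans (total-moved L v r⁺ (weigh x) v∉L) value) (kept x r⁺ 1≤x (<⇒≤ x<3)) found
      conclude (inj₂ found) = finish s τ⁺ (treated (suc x) r (s≤s z≤n) x<3 value⁺)
        (trans (total-moved L v r (weigh (suc x)) v∉L) value⁺) (kept (suc x) r (s≤s z≤n) x<3) found

    -- Weight 2 on the common edge can be traded in either direction. If the free total of `v` needs
    -- no raised edge, weight 1 with one raised edge is the alternative; otherwise one raised edge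
    -- is given up for weight 3.
    treat-pair : 1 ≤ flips L v → ∃ λ σ′ → Good (insert v′ L₁) σ′
    treat-pair 1≤k with escape-interval (low L (weigh 2) v) (values (flip L v) (total σ))
    ... | zero  , _  , ∉forbidden = treat-trading 1 (s≤s z≤n) (s≤s (s≤s z≤n)) 0 1≤k
      (subst (_∉ values (flip L v) (total σ))
        (trans (+-identityʳ _) (trans (low-weigh 1) (sym (+-comm (low L (weigh 1) v) 1)))) ∉forbidden)
    ... | suc j , j< , ∉forbidden = treat-trading 2 (s≤s z≤n) ≤-refl j
      (subst (suc j ≤_) (length-values (flip L v) (total σ)) j<) ∉forbidden

  -- Order of treatment

  treat-mobile : ∀ vs → ∃ λ L → ∃ λ σ → Good L σ × (∀ u → L u ≡ true → M u ≡ true) ×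
    (∀ u → u ∈ vs → M u ≡ true → L u ≡ true)
  -- The start has weight 2 everywhere, leaving one unit of room in each direction, and all bits 1.
  treat-mobile [] = (λ _ → false) , state (λ _ _ → 2) (λ _ → true) ,
    record { W-sym = λ _ _ → refl ; W-range = λ _ _ → s≤s z≤n , s≤s (s≤s z≤n)
           ; fresh = λ _ _ _ _ → refl ; bit = λ _ _ → refl
           ; distinct = λ _ _ () ; large = λ _ () } , (λ _ ()) , (λ _ ())
  treat-mobile (v ∷ vs) with treat-mobile vs
  ... | L , σ , g , L⊆M , all with M v in Mv | L v in Lv
  ... | false | _    = L , σ , g , L⊆M , λ { u (here refl) Mu → contradiction Mv (true≢false Mu)
                                           ; u (there u∈) Mu → all u u∈ Mu }
  ... | true  | true = L , σ , g , L⊆M , λ { u (here refl) Mu → Lv ; u (there u∈) Mu → all u u∈ Mu }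
  -- So far only mobile vertices are treated, hence every treated neighbour can be flipped.
  ... | true  | false with treat-by-flips L σ v g Lv (λ u Lu _ → L⊆M u Lu)
  ...   | σ′ , g′ = insert v L , σ′ , g′ , L⊆M′ , all′
    where
    L⊆M′ : ∀ u → insert v L u ≡ true → M u ≡ true
    L⊆M′ u Lu with insert⁻ v L Lu
    ... | inj₁ refl = Mv
    ... | inj₂ Lu′  = L⊆M u Lu′
    all′ : ∀ u → u ∈ v ∷ vs → M u ≡ true → insert v L u ≡ true
    all′ u (here refl) _  = insert-new v L
    all′ u (there u∈)  Mu = insert-old v {L} (all u u∈ Mu)

  module _ (matched : ∀ u v t → M u ≡ false → M v ≡ false → M t ≡ false →
                      A u v ≡ true → A u t ≡ true → v ≡ t)
           (2≤deg : ∀ u v → M u ≡ false → A u v ≡ true → 2 ≤ deg u) where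

    another-neighbour : ∀ v t → 2 ≤ deg v → ∃ λ u → A v u ≡ true × u ≢ t
    another-neighbour v t 2≤ with any? (λ u → A v u Bool.≟ true ×-dec ¬? (u ≟ t))
    ... | yes found = found
    ... | no none = contradiction 2≤ (<⇒≱ (s≤s (subst (_≤ 1) (sym (∑-single t off)) (at-most-one (A v t)))))
      where
      at-most-one : ∀ b → ⟦ b ⟧ ≤ 1
      at-most-one true  = ≤-refl
      at-most-one false = z≤n
      off : ∀ u → u ≢ t → ⟦ A v u ⟧ ≡ 0
      off u u≢t with A v u in Avu
      ... | false = refl
      ... | true  = contradiction (u , Avu , u≢t) none

    -- Adjacent immobile vertices enter `L` together, so an immobile vertex still to be treated
    -- never meets a treated immobile neighbour.
    Closed : (Fin n → Bool) → Set
    Closed L = ∀ u v → M u ≡ false → M v ≡ false → A u v ≡ true → L u ≡ true → L v ≡ true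

    module Immobile (L : Fin n → Bool) (σ : State) (g : Good L σ)
      (M⊆L : ∀ u → M u ≡ true → L u ≡ true) (closed : Closed L) (v : Fin n) (v∉L : L v ≡ false) where

      immobile : ∀ {u} → L u ≡ false → M u ≡ false
      immobile {u} u∉L with M u in Mu
      ... | false = refl
      ... | true  = contradiction u∉L (true≢false (M⊆L u Mu))

      Extension : Set
      Extension = ∃ λ L′ → ∃ λ σ′ → Good L′ σ′ × Closed L′ × (∀ u → L u ≡ true → L′ u ≡ true) × L′ v ≡ true

      treat-alone : ¬ (∃ λ t → A v t ≡ true × L t ≡ false) → Extension
      treat-alone none with treat-by-flips L σ v g v∉L mobile
        where
        mobile : ∀ u → L u ≡ true → A v u ≡ true → M u ≡ true
        mobile u Lu Avu with M u in Mu
        ... | true  = refl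
        -- An immobile treated neighbour would, by `closed`, have brought `v` into `L`.
        ... | false = contradiction v∉L (true≢false (closed u v Mu (immobile v∉L) (trans (A-sym u v) Avu) Lu))
      ... | σ′ , g′ = insert v L , σ′ , g′ , closed′ , (λ u → insert-old v {L}) , insert-new v L
        where
        treated : ∀ w → A v w ≡ true → L w ≡ true
        treated w Avw with L w in Lw
        ... | true  = refl
        ... | false = contradiction (w , Avw , Lw) none
        closed′ : Closed (insert v L)
        closed′ u w u∉M w∉M Auw u∈ with insert⁻ v L {u} u∈
        ... | inj₁ refl = insert-old v {L} (treated w Auw)
        ... | inj₂ Lu   = insert-old v {L} (closed u w u∉M w∉M Auw Lu)

      treat-with-mate : ∀ t → A v t ≡ true → L t ≡ false → Extension
      treat-with-mate t Avt t∉L = conclude (Pair.treat-pair L σ g v t v∉L t∉L Avt v∉M t∉M nbr nbr′ 1≤flips)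
        where
        v∉M = immobile v∉L
        t∉M = immobile t∉L
        Atv : A t v ≡ true
        Atv = trans (A-sym t v) Avt
        nbr : ∀ u → A v u ≡ true → u ≢ t → L u ≡ true × M u ≡ true
        nbr u Avu u≢t with M u in Mu
        ... | true  = M⊆L u Mu , refl
        ... | false = contradiction (matched v u t v∉M Mu t∉M Avu Avt) u≢t
        nbr′ : ∀ u → A t u ≡ true → u ≢ v → L u ≡ true × M u ≡ true
        nbr′ u Atu u≢v with M u in Mu
        ... | true  = M⊆L u Mu , refl
        ... | false = contradiction (matched t u v t∉M Mu v∉M Atu Atv) u≢v
        -- `treat-pair` trades against a raised edge at `v`, so one must be available: a neighbour
        -- of `v` other than its mate is mobile by `matched`, and already treated.
        1≤flips : 1 ≤ flips L v
        1≤flips with another-neighbour v t (2≤deg v t v∉M Avt)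
        ... | w , Avw , w≢t with nbr w Avw w≢t
        ...   | Lw , Mw = subst (_≤ flips L v) (cong ⟦_⟧ (flip⁺ L v w Avw Lw Mw))
          (term≤∑ (λ u → ⟦ flip L v u ⟧) w)
        L″ = insert t (insert v L)
        old : ∀ u → L u ≡ true → L″ u ≡ true
        old u Lu = insert-old t {insert v L} (insert-old v {L} Lu)
        v∈ : L″ v ≡ true
        v∈ = insert-old t {insert v L} (insert-new v L)
        closed″ : Closed L″
        closed″ u w u∉M w∉M Auw u∈ with insert⁻ t (insert v L) {u} u∈
        ... | inj₁ refl = subst (λ x → L″ x ≡ true) (matched t v w u∉M v∉M w∉M Atv Auw) v∈
        ... | inj₂ u∈′ with insert⁻ v L {u} u∈′
        ...   | inj₁ refl = subst (λ x → L″ x ≡ true) (matched v t w u∉M t∉M w∉M Avt Auw)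
          (insert-new t (insert v L))
        ...   | inj₂ Lu   = old w (closed u w u∉M w∉M Auw Lu)
        conclude : (∃ λ σ′ → Good L″ σ′) → Extension
        conclude (σ′ , g′) = L″ , σ′ , g′ , closed″ , old , v∈

      treat : Extension
      treat with any? (λ t → A v t Bool.≟ true ×-dec L t Bool.≟ false)
      ... | yes (t , Avt , t∉L) = treat-with-mate t Avt t∉L
      ... | no none             = treat-alone none

    treat-all : ∀ vs → ∃ λ L → ∃ λ σ → Good L σ × (∀ u → M u ≡ true → L u ≡ true) × Closed L ×
      (∀ u → u ∈ vs → L u ≡ true)
    treat-all [] with treat-mobile (allFin n)
    ... | L , σ , g , L⊆M , all =
      L , σ , g , (λ u → all u (∈-allFin u)) ,
      (λ u _ u∉M _ _ Lu → contradiction u∉M (true≢false (L⊆M u Lu))) , λ _ ()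
    treat-all (v ∷ vs) with treat-all vs
    ... | L , σ , g , M⊆L , closed , all with L v in Lv
    ... | true  = L , σ , g , M⊆L , closed , λ { u (here refl) → Lv ; u (there u∈) → all u u∈ }
    ... | false with Immobile.treat L σ g M⊆L closed v Lv
    ...   | L′ , σ′ , g′ , closed′ , old , v∈ =
      L′ , σ′ , g′ , (λ u Mu → old u (M⊆L u Mu)) , closed′ ,
      λ { u (here refl) → v∈ ; u (there u∈) → old u (all u u∈) }

    kalkowski : ∃ λ L → ∃ λ σ → Good L σ × (∀ u → L u ≡ true)
    kalkowski with treat-all (allFin n)
    ... | L , σ , g , _ , _ , all = L , σ , g , λ u → all u (∈-allFin u)

-- Sums and labels for three vertices

∑-remove : (f : Fin n → ℕ) (k : Fin n) → ∑ f ≡ f k + ∑ (λ i → if does (i ≟ k) then 0 else f i)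
∑-remove f k = begin
  ∑ f                                     ≡⟨ cong (_+ ∑ f) zero-at ⟨
  (if does (k ≟ k) then 0 else f k) + ∑ f ≡⟨ ∑-change k off ⟨
  f k + ∑ (λ i → if does (i ≟ k) then 0 else f i) ∎
  where
  open ≡-Reasoning
  zero-at : (if does (k ≟ k) then 0 else f k) ≡ 0
  zero-at rewrite ≟-refl k = refl
  off : ∀ i → i ≢ k → f i ≡ (if does (i ≟ k) then 0 else f i)
  off i i≢k rewrite ≟-≢ i≢k = refl

∑-three : (f : Fin n → ℕ) (a b c : Fin n) → a ≢ b → b ≢ c → a ≢ c →
          (∀ i → i ≢ a → i ≢ b → i ≢ c → f i ≡ 0) → ∑ f ≡ f a + (f b + f c)
∑-three f a b c a≢b b≢c a≢c off = begin
  ∑ f                  ≡⟨ ∑-remove f a ⟩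
  f a + ∑ f₁           ≡⟨ cong (f a +_) (∑-remove f₁ b) ⟩
  f a + (f₁ b + ∑ f₂)  ≡⟨ cong₂ (λ x y → f a + (x + y)) f₁-b (trans (∑-single c (λ i → f₂-off i (i ≟ a) (i ≟ b))) f₂-c) ⟩
  f a + (f b + f c)    ∎
  where
  open ≡-Reasoning
  f₁ f₂ : Fin _ → ℕ
  f₁ i = if does (i ≟ a) then 0 else f i
  f₂ i = if does (i ≟ b) then 0 else f₁ i
  f₁-b : f₁ b ≡ f b
  f₁-b rewrite ≟-≢ (a≢b ∘ sym) = refl
  f₂-c : f₂ c ≡ f c
  f₂-c rewrite ≟-≢ (b≢c ∘ sym) | ≟-≢ (a≢c ∘ sym) = refl
  f₂-off : ∀ i → Dec (i ≡ a) → Dec (i ≡ b) → i ≢ c → f₂ i ≡ 0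
  f₂-off i _          (yes refl) i≢c rewrite ≟-refl i = refl
  f₂-off i (yes refl) (no i≢b)   i≢c rewrite ≟-≢ i≢b | ≟-refl i = refl
  f₂-off i (no i≢a)   (no i≢b)   i≢c rewrite ≟-≢ i≢b | ≟-≢ i≢a = off i i≢a i≢b i≢c

-- Each of the two inequalities excludes at most one of the labels 1, 2, 3.
choose-label : ∀ p q p′ q′ → ∃ λ x → (1 ≤ x × x ≤ 3) × x + p ≢ q × x + p′ ≢ q′
choose-label p q p′ q′ with 1 + p Nat.≟ q | 1 + p′ Nat.≟ q′ | 2 + p Nat.≟ q | 2 + p′ Nat.≟ q′
... | no ne    | no ne′   | _        | _        = 1 , (s≤s z≤n , s≤s z≤n) , ne , ne′
... | _        | _        | no ne    | no ne′   = 2 , (s≤s z≤n , s≤s (s≤s z≤n)) , ne , ne′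
... | yes refl | _        | no _     | yes refl = 3 , (s≤s z≤n , ≤-refl) , (λ ()) , (λ ())
... | yes refl | _        | yes ()   | _
... | no _     | yes refl | yes refl | no _     = 3 , (s≤s z≤n , ≤-refl) , (λ ()) , (λ ())
... | no _     | yes refl | _        | yes ()

-- Cores: weighted unions of non-adjacent triples

module Cores {n : ℕ} (G : Graph n) where

  Near : (Fin n → Bool) → Fin n → Set
  Near I x = ∃ λ u → I u ≡ true × (u ≡ x ⊎ adj G u x ≡ true)

  inner : (Fin n → Bool) → (Fin n → Fin n → ℕ) → Fin n → ℕ
  inner I ψ u = ∑ λ w → if I w ∧ adj G u w then ψ u w else 0

  -- p u is the number of pendant edges attached to u.
  record Core (I : Fin n → Bool) : Set where
    field
      joined  : ∀ u → I u ≡ true → ∃ λ w → I w ≡ true × adj G u w ≡ true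
      weights : (p : Fin n → ℕ) → ∃ λ ψ → (∀ u v → ψ u v ≡ ψ v u) ×
        (∀ u v → 1 ≤ ψ u v × ψ u v ≤ 3) ×
        (∀ u v → I u ≡ true → I v ≡ true → adj G u v ≡ true → inner I ψ u + p u ≢ inner I ψ v + p v)
  open Core

  module Triple (I : Fin n → Bool) (core : Core I) (a b c : Fin n)
    (Gab : adj G a b ≡ true) (Gbc : adj G b c ≡ true) (a≢c : a ≢ c)
    (a-far : ¬ Near I a) (b-far : ¬ Near I b) (c-far : ¬ Near I c) where

    J : Fin n → Bool
    J = insert a (insert b (insert c I))

    adj⇒≢ : ∀ {u v} → adj G u v ≡ true → u ≢ v
    adj⇒≢ Guv refl = true≢false Guv (adj-irrefl G _)

    adj-flip : ∀ {u v} → adj G u v ≡ true → adj G v u ≡ true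
    adj-flip {u} {v} Guv = trans (adj-sym G v u) Guv

    data Member (u : Fin n) : Set where
      is-a : u ≡ a → Member u
      is-b : u ≡ b → Member u
      is-c : u ≡ c → Member u
      old  : I u ≡ true → Member u

    member : ∀ u → J u ≡ true → Member u
    member u Ju with insert⁻ a (insert b (insert c I)) {u} Ju
    ... | inj₁ eq = is-a eq
    ... | inj₂ Ju′ with insert⁻ b (insert c I) {u} Ju′
    ...   | inj₁ eq = is-b eq
    ...   | inj₂ Ju″ with insert⁻ c I {u} Ju″
    ...     | inj₁ eq = is-c eq
    ...     | inj₂ Iu = old Iu

    older : ∀ {u} → insert b (insert c I) u ≡ true → J u ≡ true
    older {u} = insert-old a {insert b (insert c I)} {u}
    Ja : J a ≡ true
    Ja = insert-new a (insert b (insert c I))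
    Jb : J b ≡ true
    Jb = older {b} (insert-new b (insert c I))
    Jc : J c ≡ true
    Jc = older {c} (insert-old b {insert c I} {c} (insert-new c I))
    I⊆J : ∀ u → I u ≡ true → J u ≡ true
    I⊆J u Iu = older {u} (insert-old b {insert c I} {u} (insert-old c {I} {u} Iu))

    new : Fin n → Bool
    new = insert a (insert b (insert c (λ _ → false)))

    joined′ : ∀ u → J u ≡ true → ∃ λ w → J w ≡ true × adj G u w ≡ true
    joined′ u Ju with member u Ju
    ... | is-a refl = b , Jb , Gab
    ... | is-b refl = c , Jc , Gbc
    ... | is-c refl = b , Jb , adj-flip Gbc
    ... | old Iu with joined core u Iu
    ...   | w , Iw , Guw = w , I⊆J w Iw , Guw

    old-≢ : ∀ {u} → I u ≡ true → u ≢ a × u ≢ b × u ≢ c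
    old-≢ {u} Iu = (λ eq → a-far (u , Iu , inj₁ eq)) , (λ eq → b-far (u , Iu , inj₁ eq)) ,
                   (λ eq → c-far (u , Iu , inj₁ eq))

    old-nonadj : ∀ u t → I u ≡ true → Member t → I t ≡ false → adj G u t ≡ false
    old-nonadj u t Iu m t∉I with adj G u t in Gut
    ... | false = refl
    old-nonadj u t Iu (is-a refl) t∉I | true = contradiction (u , Iu , inj₂ Gut) a-far
    old-nonadj u t Iu (is-b refl) t∉I | true = contradiction (u , Iu , inj₂ Gut) b-far
    old-nonadj u t Iu (is-c refl) t∉I | true = contradiction (u , Iu , inj₂ Gut) c-far
    old-nonadj u t Iu (old It)    t∉I | true = contradiction t∉I (true≢false It)

    module _ (p : Fin n → ℕ) where

      z : ℕ
      z = ⟦ adj G a c ⟧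

      -- With labels `x` on ab, `y` on bc and `z` for ac, the sums at `a` and `b` share `x`, so
      -- their difference depends on `y` alone. This single condition is entered twice.
      label-bc : ∃ λ y → (1 ≤ y × y ≤ 3) × y + p b ≢ z + p a × y + p b ≢ z + p a
      label-bc = choose-label (p b) (z + p a) (p b) (z + p a)
      y = proj₁ label-bc

      -- The sums at `b` and `c` share `y`, those at `a` and `c` share `z`; both conditions are left
      -- to `x`. The second is imposed on an induced path too, which saves a case distinction.
      label-ab : ∃ λ x → (1 ≤ x × x ≤ 3) × x + p b ≢ z + p c × x + p a ≢ y + p c
      label-ab = choose-label (p b) (z + p c) (p a) (y + p c)
      x = proj₁ label-ab

      ψ₀ = proj₁ (weights core p)

      -- The pairs of the triple are told apart by whether they contain `a` and `c`: ac gets 1, bc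
      -- gets `y`, ab gets `x`.
      label : Bool → Bool → ℕ
      label meets-a meets-c = if meets-c then (if meets-a then 1 else y) else x

      ψ : Fin n → Fin n → ℕ
      ψ u v = if new u ∧ new v
              then label (does (u ≟ a) ∨ does (v ≟ a)) (does (u ≟ c) ∨ does (v ≟ c))
              else ψ₀ u v

      ψ-symmetric : ∀ u v → ψ u v ≡ ψ v u
      ψ-symmetric u v
        rewrite ∧-comm (new u) (new v) | ∨-comm (does (u ≟ a)) (does (v ≟ a)) | ∨-comm (does (u ≟ c)) (does (v ≟ c))
              | proj₁ (proj₂ (weights core p)) u v = refl

      ψ-in-range : ∀ u v → 1 ≤ ψ u v × ψ u v ≤ 3
      ψ-in-range u v with new u ∧ new v
      ... | false = proj₁ (proj₂ (proj₂ (weights core p))) u v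
      ... | true with does (u ≟ a) ∨ does (v ≟ a) | does (u ≟ c) ∨ does (v ≟ c)
      ...   | _     | false = proj₁ (proj₂ label-ab)
      ...   | true  | true  = s≤s z≤n , s≤s z≤n
      ...   | false | true  = proj₁ (proj₂ label-bc)

      a≢b = adj⇒≢ Gab
      b≢c = adj⇒≢ Gbc

      term : Fin n → Fin n → ℕ
      term u w = if J w ∧ adj G u w then ψ u w else 0

      term-off : ∀ u → Member u → I u ≡ false → ∀ w → w ≢ a → w ≢ b → w ≢ c → term u w ≡ 0
      term-off u m u∉I w w≢a w≢b w≢c rewrite ≟-≢ w≢a | ≟-≢ w≢b | ≟-≢ w≢c with I w in Iw
      ... | false = refl
      ... | true rewrite adj-sym G u w | old-nonadj w u Iw m u∉I = refl

      fresh-a : I a ≡ false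
      fresh-a with I a in Ia
      ... | false = refl
      ... | true  = contradiction (a , Ia , inj₁ refl) a-far
      fresh-b : I b ≡ false
      fresh-b with I b in Ib
      ... | false = refl
      ... | true  = contradiction (b , Ib , inj₁ refl) b-far
      fresh-c : I c ≡ false
      fresh-c with I c in Ic
      ... | false = refl
      ... | true  = contradiction (c , Ic , inj₁ refl) c-far

      inner-a : inner J ψ a ≡ x + z
      inner-a = trans (∑-three (term a) a b c a≢b b≢c a≢c (term-off a (is-a refl) fresh-a))
        (cong₂ _+_ at-a (cong₂ _+_ at-b at-c))
        where
        at-a : term a a ≡ 0
        at-a rewrite Ja | adj-irrefl G a = refl
        at-b : term a b ≡ x
        at-b rewrite Jb | Gab | ≟-refl a | ≟-refl b | ≟-≢ a≢c | ≟-≢ b≢c | ∨-zeroʳ (does (b ≟ a)) = refl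
        at-c : term a c ≡ z
        at-c rewrite Jc | ≟-refl a | ≟-refl c | ∨-zeroʳ (does (c ≟ b)) | ∨-zeroʳ (does (c ≟ a)) | ∨-zeroʳ (does (a ≟ c)) = refl

      inner-b : inner J ψ b ≡ x + y
      inner-b = trans (∑-three (term b) a b c a≢b b≢c a≢c (term-off b (is-b refl) fresh-b))
        (cong₂ _+_ at-a (trans (cong₂ _+_ at-b at-c) refl))
        where
        at-a : term b a ≡ x
        at-a rewrite Ja | adj-flip Gab | ≟-refl a | ≟-refl b | ≟-≢ a≢c | ≟-≢ b≢c | ∨-zeroʳ (does (b ≟ a)) = refl
        at-b : term b b ≡ 0
        at-b rewrite adj-irrefl G b | Jb = refl
        at-c : term b c ≡ y
        at-c rewrite Jc | Gbc | ≟-refl b | ≟-refl c | ≟-≢ (a≢b ∘ sym) | ≟-≢ (a≢c ∘ sym) | ≟-≢ (b≢c ∘ sym) | ∨-zeroʳ (does (b ≟ c)) = refl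

      inner-c : inner J ψ c ≡ y + z
      inner-c = trans (∑-three (term c) a b c a≢b b≢c a≢c (term-off c (is-c refl) fresh-c))
        (trans (cong₂ _+_ at-a (cong₂ _+_ at-b at-c)) (trans (cong (z +_) (+-identityʳ y)) (+-comm z y)))
        where
        at-a : term c a ≡ z
        at-a rewrite Ja | adj-sym G c a | ≟-refl a | ≟-refl c | ∨-zeroʳ (does (c ≟ b)) | ∨-zeroʳ (does (c ≟ a)) = refl
        at-b : term c b ≡ y
        at-b rewrite Jb | adj-flip Gbc | ≟-refl b | ≟-refl c | ≟-≢ (a≢b ∘ sym) | ≟-≢ (a≢c ∘ sym) | ≟-≢ (b≢c ∘ sym) = refl
        at-c : term c c ≡ 0
        at-c rewrite adj-irrefl G c | Jc = refl

      -- The triple is far from `I`: it contributes no edge at `u`, and pairs of old vertices keep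
      -- their weights.
      inner-old : ∀ u → I u ≡ true → inner J ψ u ≡ inner I ψ₀ u
      inner-old u Iu = sum-cong-≗ λ w → same w (w ≟ a) (w ≟ b) (w ≟ c)
        where
        u-old : new u ≡ false
        u-old rewrite ≟-≢ (proj₁ (old-≢ Iu)) | ≟-≢ (proj₁ (proj₂ (old-≢ Iu))) | ≟-≢ (proj₂ (proj₂ (old-≢ Iu))) = refl
        nonadj : ∀ w → Member w → I w ≡ false → term u w ≡ (if I w ∧ adj G u w then ψ₀ u w else 0)
        nonadj w m w∉I rewrite old-nonadj u w Iu m w∉I | ∧-zeroʳ (J w) | ∧-zeroʳ (I w) = refl
        same : ∀ w → Dec (w ≡ a) → Dec (w ≡ b) → Dec (w ≡ c) →
          term u w ≡ (if I w ∧ adj G u w then ψ₀ u w else 0)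
        same w (yes refl) _ _ = nonadj w (is-a refl) fresh-a
        same w (no _) (yes refl) _ = nonadj w (is-b refl) fresh-b
        same w (no _) (no _) (yes refl) = nonadj w (is-c refl) fresh-c
        same w (no w≢a) (no w≢b) (no w≢c) rewrite ≟-≢ w≢a | ≟-≢ w≢b | ≟-≢ w≢c | u-old = refl

      a≁b : inner J ψ a + p a ≢ inner J ψ b + p b
      a≁b eq = proj₁ (proj₂ (proj₂ label-bc)) (sym (+-cancelˡ-≡ x _ _ (begin
        x + (z + p a)      ≡⟨ +-assoc x z _ ⟨
        x + z + p a        ≡⟨ cong (_+ p a) inner-a ⟨
        inner J ψ a + p a  ≡⟨ eq ⟩
        inner J ψ b + p b  ≡⟨ cong (_+ p b) inner-b ⟩
        x + y + p b        ≡⟨ +-assoc x y _ ⟩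
        x + (y + p b)      ∎)))
        where open ≡-Reasoning

      b≁c : inner J ψ b + p b ≢ inner J ψ c + p c
      b≁c eq = proj₁ (proj₂ (proj₂ label-ab)) (+-cancelˡ-≡ y _ _ (begin
        y + (x + p b)      ≡⟨ solve 3 (λ x y p → y :+ (x :+ p) := x :+ y :+ p) refl x y (p b) ⟩
        x + y + p b        ≡⟨ cong (_+ p b) inner-b ⟨
        inner J ψ b + p b  ≡⟨ eq ⟩
        inner J ψ c + p c  ≡⟨ cong (_+ p c) inner-c ⟩
        y + z + p c        ≡⟨ +-assoc y z _ ⟩
        y + (z + p c)      ∎))
        where open ≡-Reasoning

      a≁c : inner J ψ a + p a ≢ inner J ψ c + p c
      a≁c eq = proj₂ (proj₂ (proj₂ label-ab)) (+-cancelˡ-≡ z _ _ (begin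
        z + (x + p a)      ≡⟨ solve 3 (λ x z p → z :+ (x :+ p) := x :+ z :+ p) refl x z (p a) ⟩
        x + z + p a        ≡⟨ cong (_+ p a) inner-a ⟨
        inner J ψ a + p a  ≡⟨ eq ⟩
        inner J ψ c + p c  ≡⟨ cong (_+ p c) inner-c ⟩
        y + z + p c        ≡⟨ solve 3 (λ y z p → y :+ z :+ p := z :+ (y :+ p)) refl y z (p c) ⟩
        z + (y + p c)      ∎))
        where open ≡-Reasoning

      separated : ∀ u v → J u ≡ true → J v ≡ true → adj G u v ≡ true → inner J ψ u + p u ≢ inner J ψ v + p v
      separated u v Ju Jv Guv with member u Ju | member v Jv
      ... | is-a refl | is-a eq   = contradiction (sym eq) (adj⇒≢ Guv)
      ... | is-a refl | is-b refl = a≁b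
      ... | is-a refl | is-c refl = a≁c
      ... | is-b refl | is-a refl = a≁b ∘ sym
      ... | is-b refl | is-b eq   = contradiction (sym eq) (adj⇒≢ Guv)
      ... | is-b refl | is-c refl = b≁c
      ... | is-c refl | is-a refl = a≁c ∘ sym
      ... | is-c refl | is-b refl = b≁c ∘ sym
      ... | is-c refl | is-c eq   = contradiction (sym eq) (adj⇒≢ Guv)
      ... | is-a refl | old Iv    = contradiction (v , Iv , inj₂ (adj-flip Guv)) a-far
      ... | is-b refl | old Iv    = contradiction (v , Iv , inj₂ (adj-flip Guv)) b-far
      ... | is-c refl | old Iv    = contradiction (v , Iv , inj₂ (adj-flip Guv)) c-far
      ... | old Iu    | is-a refl = contradiction (u , Iu , inj₂ Guv) a-far
      ... | old Iu    | is-b refl = contradiction (u , Iu , inj₂ Guv) b-far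
      ... | old Iu    | is-c refl = contradiction (u , Iu , inj₂ Guv) c-far
      ... | old Iu    | old Iv    = subst₂ (λ s t → s + p u ≢ t + p v)
        (sym (inner-old u Iu)) (sym (inner-old v Iv))
        (proj₂ (proj₂ (proj₂ (weights core p))) u v Iu Iv Guv)

    core′ : Core J
    core′ = record
      { joined  = joined′
      ; weights = λ p → ψ p , ψ-symmetric p , ψ-in-range p , separated p }

  Path : Fin n × Fin n × Fin n → Set
  Path (a , b , c) = adj G a b ≡ true × adj G b c ≡ true × a ≢ c

  Meets : (Fin n → Bool) → Fin n × Fin n × Fin n → Set
  Meets I (a , b , c) = Near I a ⊎ Near I b ⊎ Near I c

  near? : ∀ I x → Dec (Near I x)
  near? I x = any? λ u → I u Bool.≟ true ×-dec (u ≟ x ⊎-dec adj G u x Bool.≟ true)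

  -- A greedy choice suffices, since `Near` only grows with `I`: a triple once rejected, or once
  -- added, meets every later set.
  maximal-core : ∀ ts → ∃ λ I → Core I × (∀ t → t ∈ ts → Path t → Meets I t)
  maximal-core [] = (λ _ → false) , record
    { joined  = λ _ ()
    ; weights = λ p → (λ _ _ → 1) , (λ _ _ → refl) , (λ _ _ → s≤s z≤n , s≤s z≤n) , λ _ _ () } , λ _ ()
  maximal-core (t@(a , b , c) ∷ ts) with maximal-core ts
  ... | I , core , met
    with adj G a b Bool.≟ true ×-dec adj G b c Bool.≟ true ×-dec ¬? (a ≟ c)
       | near? I a ⊎-dec near? I b ⊎-dec near? I c
  ... | no ¬path | _     = I , core , λ { _ (here refl) path → contradiction path ¬path
                                        ; s (there s∈) path → met s s∈ path }
  ... | yes _    | yes m = I , core , λ { _ (here refl) _ → m ; s (there s∈) path → met s s∈ path }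
  ... | yes (Gab , Gbc , a≢c) | no far = J , core′ , met′
    where
    open Triple I core a b c Gab Gbc a≢c (far ∘ inj₁) (far ∘ inj₂ ∘ inj₁) (far ∘ inj₂ ∘ inj₂)
    grow : ∀ {x} → Near I x → Near J x
    grow (u , Iu , h) = u , I⊆J u Iu , h
    met′ : ∀ s → s ∈ t ∷ ts → Path s → Meets J s
    met′ _ (here refl) _ = inj₁ (a , Ja , inj₁ refl)
    met′ s (there s∈) path = Sum.map grow (Sum.map grow grow) (met s s∈ path)

-- Mobile vertices in a regular graph

module Decomposition {n d : ℕ} (G : Graph n) (regular : Regular d G) (2≤d : 2 ≤ d)
  (I : Fin n → Bool) (core : Cores.Core G I)
  (meets : ∀ a b c → Cores.Path G (a , b , c) → Cores.Meets G I (a , b , c)) where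

  open Cores G using (Near; inner)
  open Cores.Core core

  -- Vertices of `I` stay in the graph as isolated, immobile vertices, so the algorithm runs on the
  -- original vertex set.
  A : Fin n → Fin n → Bool
  A u v = adj G u v ∧ (not (I u) ∧ not (I v))

  A-sym : ∀ u v → A u v ≡ A v u
  A-sym u v = cong₂ _∧_ (adj-sym G u v) (∧-comm (not (I u)) (not (I v)))

  A-irrefl : ∀ v → A v v ≡ false
  A-irrefl v rewrite adj-irrefl G v = refl

  attached? : ∀ v → Dec (∃ λ u → adj G v u ≡ true × I u ≡ true)
  attached? v = any? λ u → adj G v u Bool.≟ true ×-dec I u Bool.≟ true

  M : Fin n → Bool
  M v = not (I v) ∧ does (attached? v)

  anchor : Fin n → Fin n
  anchor v with attached? v
  ... | yes (u , _) = u
  -- A default value; `drop` consults the anchors of mobile vertices only.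
  ... | no _        = v

  anchor-spec : ∀ v → M v ≡ true → adj G v (anchor v) ≡ true × I (anchor v) ≡ true
  anchor-spec v Mv with I v | attached? v
  ... | false | yes (u , h) = h

  M⇒∉I : ∀ v → M v ≡ true → I v ≡ false
  M⇒∉I v Mv with I v
  ... | false = refl

  c : Fin n → ℕ
  c v = ∑ λ u → ⟦ adj G v u ∧ I u ⟧

  module Kal = Kalkowski A A-sym A-irrefl M c
  open Kal

  A⇒∉I : ∀ u v → A u v ≡ true → I u ≡ false × I v ≡ false × adj G u v ≡ true
  A⇒∉I u v Auv with adj G u v | I u | I v
  ... | true | false | false = refl , refl , refl

  isolated : ∀ v u → I v ≡ false → M v ≡ false → adj G v u ≡ true → I u ≡ false
  isolated v u Iv Mv Gvu with I u in Iu
  ... | false = refl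
  ... | true rewrite Iv = contradiction Mv (true≢false (dec-true (attached? v) (u , Gvu , Iu)))

  not-near : ∀ v → I v ≡ false → M v ≡ false → ¬ Near I v
  not-near v Iv Mv (u , Iu , inj₁ refl) = true≢false Iu Iv
  not-near v Iv Mv (u , Iu , inj₂ Guv)  = true≢false Iu (isolated v u Iv Mv (trans (adj-sym G v u) Guv))

  -- Otherwise `v`, `u`, `t` would form a path none of whose vertices lies in `I` or next to it,
  -- against the maximality of `I`.
  matched : ∀ u v t → M u ≡ false → M v ≡ false → M t ≡ false → A u v ≡ true → A u t ≡ true → v ≡ t
  matched u v t Mu Mv Mt Auv Aut with v ≟ t | A⇒∉I u v Auv | A⇒∉I u t Aut
  ... | yes v≡t | _ | _ = v≡t
  ... | no v≢t | Iu , Iv , Guv | _ , It , Gut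
    with meets v u t (trans (adj-sym G v u) Guv , Gut , v≢t)
  ...   | inj₁ near        = contradiction near (not-near v Iv Mv)
  ...   | inj₂ (inj₁ near) = contradiction near (not-near u Iu Mu)
  ...   | inj₂ (inj₂ near) = contradiction near (not-near t It Mt)

  ∑-degree : ∀ v → ∑ (λ u → ⟦ adj G v u ⟧) ≡ d
  ∑-degree v = trans (sym (sum-allFin (λ u → ⟦ adj G v u ⟧))) (regular v)

  c+deg : ∀ v → I v ≡ false → c v + deg v ≡ d
  c+deg v Iv = trans (sym (∑-distrib-+ (λ u → ⟦ adj G v u ∧ I u ⟧) (λ u → ⟦ A v u ⟧)))
    (trans (sum-cong-≗ split) (∑-degree v))
    where
    split : ∀ u → ⟦ adj G v u ∧ I u ⟧ + ⟦ A v u ⟧ ≡ ⟦ adj G v u ⟧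
    split u rewrite Iv with adj G v u | I u
    ... | false | _     = refl
    ... | true  | true  = refl
    ... | true  | false = refl

  -- An immobile vertex outside `I` has no neighbour in `I`, so `A` retains all its `d` edges.
  2≤deg : ∀ u v → M u ≡ false → A u v ≡ true → 2 ≤ deg u
  2≤deg u v Mu Auv with A⇒∉I u v Auv
  ... | Iu , _ = subst (2 ≤_) (trans (sym (c+deg u Iu)) (cong (_+ deg u) (∑-zero none))) 2≤d
    where
    none : ∀ w → ⟦ adj G u w ∧ I w ⟧ ≡ 0
    none w with adj G u w in Guw
    ... | false = refl
    ... | true rewrite isolated u w Iu Mu Guw = refl

  -- The two graphs and their weightings

  module Split (L : Fin n → Bool) (σ : State) (good : Good L σ) (everywhere : ∀ u → L u ≡ true) where

    open State σ
    open Good good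

    -- The edge from v to its anchor is moved to the second graph exactly when
    -- the bit of v is 0.
    drop : Fin n → Fin n → Bool
    drop v u = M v ∧ (not (β v) ∧ does (anchor v ≟ u))

    drop⁻ : ∀ v u → drop v u ≡ true → I v ≡ false × I u ≡ true × adj G v u ≡ true
    drop⁻ v u eq with ∧-split {M v} eq
    ... | Mv , eq′ with ∧-split {not (β v)} eq′
    ...   | _ , eq″ with anchor v ≟ u
    ...     | yes refl = M⇒∉I v Mv , proj₂ (anchor-spec v Mv) , proj₁ (anchor-spec v Mv)

    drop-from-I : ∀ v u → I v ≡ true → drop v u ≡ false
    drop-from-I v u Iv rewrite Iv = refl

    drop-to-∉I : ∀ v u → I u ≡ false → drop v u ≡ false
    drop-to-∉I v u Iu with drop v u in eq
    ... | false = refl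
    ... | true  = contradiction Iu (true≢false (proj₁ (proj₂ (drop⁻ v u eq))))

    -- Bit 1 moves no edge and bit 0 moves exactly the anchor edge; a vertex without an anchor has
    -- bit 1 by the invariant.
    ∑-drop : ∀ v → I v ≡ false → ⟦ β v ⟧ + ∑ (λ u → ⟦ drop v u ⟧) ≡ 1
    ∑-drop v Iv = by-cases (β v) (M v) refl refl
      where
      by-cases : ∀ b m → β v ≡ b → M v ≡ m → ⟦ β v ⟧ + ∑ (λ u → ⟦ drop v u ⟧) ≡ 1
      by-cases true  _     βv _  = cong₂ _+_ (cong ⟦_⟧ βv) (∑-zero {n} {λ u → ⟦ drop v u ⟧} λ u →
        trans (cong (λ b → ⟦ M v ∧ (not b ∧ does (anchor v ≟ u)) ⟧) βv) (cong ⟦_⟧ (∧-zeroʳ (M v))))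
      by-cases false false βv Mv = contradiction βv (true≢false (bit v (inj₂ Mv)))
      by-cases false true  βv Mv = trans
        (cong₂ _+_ (cong ⟦_⟧ βv) (sum-cong-≗ λ u → cong₂ (λ m b → ⟦ m ∧ (not b ∧ does (anchor v ≟ u)) ⟧) Mv βv))
        (trans (∑-single (anchor v) λ u u≢ → cong ⟦_⟧ (≟-≢ (u≢ ∘ sym))) (cong ⟦_⟧ (≟-refl (anchor v))))

    second : Fin n → Fin n → Bool
    second u v = (I u ∧ I v) ∨ (drop u v ∨ drop v u)

    second-sym : ∀ u v → second u v ≡ second v u
    second-sym u v = cong₂ _∨_ (∧-comm (I u) (I v)) (∨-comm (drop u v) (drop v u))

    G₁ G₂ : Graph n
    G₁ = record
      { adj = λ u v → adj G u v ∧ not (second u v)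
      ; sym = λ u v → cong₂ (λ a b → a ∧ not b) (adj-sym G u v) (second-sym u v)
      ; irrefl = λ v → cong (_∧ not (second v v)) (adj-irrefl G v) }
    G₂ = record
      { adj = λ u v → adj G u v ∧ second u v
      ; sym = λ u v → cong₂ _∧_ (adj-sym G u v) (second-sym u v)
      ; irrefl = λ v → cong (_∧ second v v) (adj-irrefl G v) }

    decomposed : DecomposedInto G G₁ G₂
    decomposed = (λ u v → union (adj G u v) (second u v)) , (λ u v → disjoint (adj G u v) (second u v))
      where
      union : ∀ a b → a ≡ (a ∧ not b) ∨ (a ∧ b)
      union false _     = refl
      union true  true  = refl
      union true  false = refl
      disjoint : ∀ a b → (a ∧ not b) ∧ (a ∧ b) ≡ false
      disjoint false _     = refl
      disjoint true  true  = refl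
      disjoint true  false = refl

    w₁ : Weighting G₁
    w₁ = record
      { ω = λ u v → if A u v then W u v else 1
      ; ω-sym = λ u v → cong₂ (λ a x → if a then x else 1) (A-sym u v) (W-sym u v)
      ; ω-range = λ u v _ → range u v }
      where
      range : ∀ u v → 1 ≤ (if A u v then W u v else 1) × (if A u v then W u v else 1) ≤ 3
      range u v with A u v
      ... | true  = W-range u v
      ... | false = s≤s z≤n , s≤s z≤n

    p : Fin n → ℕ
    p u = ∑ λ w → ⟦ drop w u ⟧

    ψ = proj₁ (weights p)

    w₂ : Weighting G₂
    w₂ = record
      { ω = λ u v → if I u ∧ I v then ψ u v else 1
      ; ω-sym = λ u v → cong₂ (λ a x → if a then x else 1) (∧-comm (I u) (I v)) (proj₁ (proj₂ (weights p)) u v)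
      ; ω-range = λ u v _ → range u v }
      where
      range : ∀ u v → 1 ≤ (if I u ∧ I v then ψ u v else 1) × (if I u ∧ I v then ψ u v else 1) ≤ 3
      range u v with I u ∧ I v
      ... | true  = proj₁ (proj₂ (proj₂ (weights p))) u v
      ... | false = s≤s z≤n , s≤s z≤n

    term : {H : Graph n} → Weighting H → Fin n → Fin n → ℕ
    term {H} w v u = if adj H v u then ω w v u else 0

    vsum-∑ : {H : Graph n} (w : Weighting H) (v : Fin n) → vsum w v ≡ ∑ (term w v)
    vsum-∑ w v = sum-allFin (term w v)

    -- `c` counts the anchor edge even when it has been moved, and the bit together with the number
    -- of moved edges is always 1. The offset is the same at every vertex, so distinct totals give
    -- distinct sums.
    vsum₁-∉I : ∀ v → I v ≡ false → total σ v ≡ suc (vsum w₁ v)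
    vsum₁-∉I v Iv = begin
      ⟦ β v ⟧ + (c v + ∑ (λ u → if A v u then W v u else 0))
        ≡⟨ cong (⟦ β v ⟧ +_) (∑-distrib-+ (λ u → ⟦ adj G v u ∧ I u ⟧) _) ⟨
      ⟦ β v ⟧ + ∑ (λ u → ⟦ adj G v u ∧ I u ⟧ + (if A v u then W v u else 0))
        ≡⟨ cong (⟦ β v ⟧ +_) (sum-cong-≗ λ u → pointwise u (I u) refl) ⟨
      ⟦ β v ⟧ + ∑ (λ u → ⟦ drop v u ⟧ + term w₁ v u)
        ≡⟨ cong (⟦ β v ⟧ +_) (∑-distrib-+ (λ u → ⟦ drop v u ⟧) _) ⟩
      ⟦ β v ⟧ + (∑ (λ u → ⟦ drop v u ⟧) + ∑ (term w₁ v))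
        ≡⟨ +-assoc ⟦ β v ⟧ _ _ ⟨
      ⟦ β v ⟧ + ∑ (λ u → ⟦ drop v u ⟧) + ∑ (term w₁ v)
        ≡⟨ cong₂ _+_ (∑-drop v Iv) (sym (vsum-∑ w₁ v)) ⟩
      suc (vsum w₁ v) ∎
      where
      open ≡-Reasoning
      pointwise : ∀ u i → I u ≡ i → ⟦ drop v u ⟧ + term w₁ v u ≡ ⟦ adj G v u ∧ I u ⟧ + (if A v u then W v u else 0)
      pointwise u false Iu rewrite drop-to-∉I v u Iu | drop-to-∉I u v Iv | Iv | Iu | ∧-identityʳ (adj G v u)
        | ∧-zeroʳ (adj G v u) with adj G v u
      ... | true  = refl
      ... | false = refl
      pointwise u true Iu = go (drop v u) refl
        where
        go : ∀ b → drop v u ≡ b → ⟦ drop v u ⟧ + term w₁ v u ≡ ⟦ adj G v u ∧ I u ⟧ + (if A v u then W v u else 0)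
        go true  Dvu rewrite Dvu | proj₂ (proj₂ (drop⁻ v u Dvu)) | Iv | Iu = refl
        go false Dvu rewrite Dvu | drop-from-I u v Iu | Iv | Iu with adj G v u
        ... | true  = refl
        ... | false = refl

    vsum₁-I : ∀ u → I u ≡ true → vsum w₁ u < d
    vsum₁-I u Iu with joined u Iu
    ... | w , Iw , Guw = subst₂ _<_ (sym (vsum-∑ w₁ u)) (∑-degree u) (∑-mono-< pointwise w strict)
      where
      pointwise : ∀ t → term w₁ u t ≤ ⟦ adj G u t ⟧
      pointwise t = subst (λ b → (if adj G₁ u t then (if b then W u t else 1) else 0) ≤ ⟦ adj G u t ⟧)
        (sym A-false) (bound (adj G u t) (second u t))
        where
        A-false : A u t ≡ false
        A-false rewrite Iu = ∧-zeroʳ (adj G u t)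
        bound : ∀ a b → (if a ∧ not b then 1 else 0) ≤ ⟦ a ⟧
        bound false _     = z≤n
        bound true  true  = z≤n
        bound true  false = ≤-refl
      strict : term w₁ u w < ⟦ adj G u w ⟧
      strict rewrite Iu | Iw | Guw = ≤-refl

    -- The extra 1 in `large` pays for the offset between total and sum; the rest is `d` by
    -- regularity.
    vsum₁-large : ∀ v → I v ≡ false → d ≤ vsum w₁ v
    vsum₁-large v Iv = subst (_≤ vsum w₁ v) (c+deg v Iv)
      (≤-pred (subst (suc (c v + deg v) ≤_) (vsum₁-∉I v Iv) (large v (everywhere v))))

    fulfills₁ : Fulfills123 G₁
    fulfills₁ = w₁ , λ u v G₁uv → go u v G₁uv (I u) (I v) refl refl
      where
      go : ∀ u v → adj G₁ u v ≡ true → ∀ i j → I u ≡ i → I v ≡ j → vsum w₁ u ≢ vsum w₁ v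
      go u v G₁uv true true Iu Iv _ with ∧-split {adj G u v} G₁uv
      ... | _ , inside rewrite Iu | Iv = contradiction refl (true≢false inside)
      go u v _ true  false Iu Iv = <⇒≢ (<-≤-trans (vsum₁-I u Iu) (vsum₁-large v Iv))
      go u v _ false true  Iu Iv = <⇒≢ (<-≤-trans (vsum₁-I v Iv) (vsum₁-large u Iu)) ∘ sym
      go u v G₁uv false false Iu Iv eq = distinct u v (everywhere u) (everywhere v) Auv
        (trans (vsum₁-∉I u Iu) (trans (cong suc eq) (sym (vsum₁-∉I v Iv))))
        where
        Auv : A u v ≡ true
        Auv rewrite Iu | Iv | proj₁ (∧-split {adj G u v} G₁uv) = refl

    vsum₂-I : ∀ u → I u ≡ true → vsum w₂ u ≡ inner I ψ u + p u
    vsum₂-I u Iu = trans (vsum-∑ w₂ u) (trans (sum-cong-≗ λ w → pointwise w (I w) refl)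
      (∑-distrib-+ (λ w → if I w ∧ adj G u w then ψ u w else 0) _))
      where
      pointwise : ∀ w i → I w ≡ i → term w₂ u w ≡ (if I w ∧ adj G u w then ψ u w else 0) + ⟦ drop w u ⟧
      pointwise w true Iw rewrite drop-from-I w u Iw | Iu | Iw | ∧-identityʳ (adj G u w) = sym (+-identityʳ _)
      pointwise w false Iw = go (drop w u) refl
        where
        go : ∀ b → drop w u ≡ b → term w₂ u w ≡ (if I w ∧ adj G u w then ψ u w else 0) + ⟦ drop w u ⟧
        go true  Dwu rewrite Dwu | adj-sym G u w | proj₂ (proj₂ (drop⁻ w u Dwu)) | drop-from-I u w Iu | Iu | Iw = refl
        go false Dwu rewrite Dwu | drop-from-I u w Iu | Iu | Iw | ∧-zeroʳ (adj G u w) = refl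

    -- The only edge that `v` can have in the second graph is its anchor edge, of weight 1.
    vsum₂-∉I : ∀ v → I v ≡ false → vsum w₂ v ≤ 1
    vsum₂-∉I v Iv = subst (_≤ 1) (sym (vsum-∑ w₂ v)) (≤-trans (∑-mono λ u → pointwise u (I u) refl)
      (subst (∑ (λ u → ⟦ drop v u ⟧) ≤_) (∑-drop v Iv) (m≤n+m _ ⟦ β v ⟧)))
      where
      pointwise : ∀ u i → I u ≡ i → term w₂ v u ≤ ⟦ drop v u ⟧
      pointwise u false Iu rewrite drop-to-∉I v u Iu | drop-to-∉I u v Iv | Iv | ∧-zeroʳ (adj G v u) = z≤n
      pointwise u true  Iu = subst₂ (λ s i → (if adj G v u ∧ s then (if i ∧ I u then ψ v u else 1) else 0) ≤ ⟦ drop v u ⟧)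
        (sym second-vu) (sym Iv) (bound (adj G v u) (drop v u))
        where
        second-vu : second v u ≡ drop v u
        second-vu = trans (cong₂ (λ i e → (i ∧ I u) ∨ (drop v u ∨ e)) Iv (drop-from-I u v Iu)) (∨-identityʳ (drop v u))
        bound : ∀ a b → (if a ∧ b then 1 else 0) ≤ ⟦ b ⟧
        bound false _     = z≤n
        bound true  false = z≤n
        bound true  true  = ≤-refl

    -- An edge inside `I` and the pendant edge itself both count at `u`, which puts `u` above the
    -- pendant vertex.
    2≤vsum₂ : ∀ u v → I u ≡ true → drop v u ≡ true → 2 ≤ vsum w₂ u
    2≤vsum₂ u v Iu Dvu with joined u Iu
    ... | w , Iw , Guw = subst (2 ≤_) (sym (vsum₂-I u Iu)) (+-mono-≤ 1≤inner 1≤p)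
      where
      1≤inner : 1 ≤ inner I ψ u
      1≤inner = ≤-trans (subst (1 ≤_) (cong₂ (λ a b → if a ∧ b then ψ u w else 0) (sym Iw) (sym Guw))
        (proj₁ (proj₁ (proj₂ (proj₂ (weights p))) u w)))
        (term≤∑ (λ t → if I t ∧ adj G u t then ψ u t else 0) w)
      1≤p : 1 ≤ p u
      1≤p = subst (_≤ p u) (cong ⟦_⟧ Dvu) (term≤∑ (λ t → ⟦ drop t u ⟧) v)

    pendant-< : ∀ u v → I u ≡ true → I v ≡ false → adj G₂ u v ≡ true → vsum w₂ v < vsum w₂ u
    pendant-< u v Iu Iv G₂uv = <-≤-trans (s≤s (vsum₂-∉I v Iv)) (2≤vsum₂ u v Iu dropped)
      where
      dropped : drop v u ≡ true
      dropped with proj₂ (∧-split {adj G u v} G₂uv)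
      ... | inside rewrite drop-from-I u v Iu | Iu | Iv = inside

    fulfills₂ : Fulfills123 G₂
    fulfills₂ = w₂ , λ u v G₂uv → go u v G₂uv (I u) (I v) refl refl
      where
      go : ∀ u v → adj G₂ u v ≡ true → ∀ i j → I u ≡ i → I v ≡ j → vsum w₂ u ≢ vsum w₂ v
      go u v G₂uv true  true  Iu Iv = subst₂ _≢_ (sym (vsum₂-I u Iu)) (sym (vsum₂-I v Iv))
        (proj₂ (proj₂ (proj₂ (weights p))) u v Iu Iv (proj₁ (∧-split {adj G u v} G₂uv)))
      go u v G₂uv true  false Iu Iv = <⇒≢ (pendant-< u v Iu Iv G₂uv) ∘ sym
      go u v G₂uv false true  Iu Iv = <⇒≢ (pendant-< v u Iv Iu (trans (Graph.sym G₂ v u) G₂uv))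
      go u v G₂uv false false Iu Iv with proj₂ (∧-split {adj G u v} G₂uv)
      ... | inside rewrite drop-to-∉I u v Iv | drop-to-∉I v u Iu | Iu = contradiction refl (true≢false inside)

theorem7 : (d : ℕ) → 14 ≤ d → d ≢ 15 → d ≢ 17 →
    (n : ℕ) (G : Graph n) → Regular d G →
    Σ (Graph n) λ G₁ → Σ (Graph n) λ G₂ →
    DecomposedInto G G₁ G₂ × Fulfills123 G₁ × Fulfills123 G₂
theorem7 d 14≤d _ _ n G regular = G₁ , G₂ , decomposed , fulfills₁ , fulfills₂
  where
  found = Cores.maximal-core G (cartesianProduct (allFin n) (cartesianProduct (allFin n) (allFin n)))
  module D = Decomposition G regular (≤-trans (s≤s (s≤s z≤n)) 14≤d) (proj₁ found) (proj₁ (proj₂ found))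
    (λ a b c → proj₂ (proj₂ found) (a , b , c)
      (∈-cartesianProduct⁺ (∈-allFin a) (∈-cartesianProduct⁺ (∈-allFin b) (∈-allFin c))))
  run = D.Kal.kalkowski D.matched D.2≤deg
  open D.Split (proj₁ run) (proj₁ (proj₂ run)) (proj₁ (proj₂ (proj₂ run))) (proj₂ (proj₂ (proj₂ run)))
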